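{- Let $\mathcal{C}$ be a partition of $\mathbb{E}^9$ into $13$ codes, each of minimum distance at least $4$. (i) If $\mathcal{C}$ contains a code $C$ that is the doubly extended Hamming code (up to equivalence under $G_9$) and $|\mathrm{Aut}(\mathcal{C})|\geq 2$, then there is a subgroup $H \leq \mathrm{Aut}(\mathcal{C})$ of prime order which is also a subgroup of $\mathrm{Aut}(C)$. (ii) If $|\mathrm{Aut}(\mathcal{C})|\geq 3$, then there is a subgroup $H \leq \mathrm{Aut}(\mathcal{C})$ whose order is $4$ or an odd prime such that $H\leq \mathrm{Aut}(C)$ for some code $C \in \mathcal{C}$.
   Context: $\mathbb{E}^n$ is the set of binary words of length $n$ with even Hamming weight; a code is a subset of $\mathbb{E}^n$, and its minimum distance is the smallest Hamming distance between two distinct codewords. $G_n$ is the group of all maps $\mathbb{E}^n\to\mathbb{E}^n$ of the form $x \mapsto \pi(x) + c$, where $\pi$ permutes the coordinates and $c \in \mathbb{E}^n$. For $g\in G_n$, $gC=\{gc: c\in C\}$ and $g\mathcal{C}=\{gC : C\in\mathcal{C}\}$; $\mathrm{Aut}(C)=\{g\in G_n : gC=C\}$, $\mathrm{Aut}(\mathcal{C})=\{g\in G_n : g\mathcal{C}=\mathcal{C}\}$. Two codes are equivalent if one is the image of the other under an element of $G_n$. A partition of $\mathbb{E}^n$ into codes is a set of pairwise disjoint codes with union $\mathbb{E}^n$. The Hamming code of length $7$ is the binary linear code of length $7$ and size $16$ with minimum distance $3$ (the null space of a $3\times 7$ binary matrix whose columns are the seven nonzero vectors of $\mathbb{F}_2^3$);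 the extended Hamming code is obtained by appending a parity bit to each codeword (an even code of length $8$, size $16$, minimum distance $4$), and the doubly extended Hamming code is obtained by further appending a $0$ to each codeword, giving an even code of length $9$, size $16$, minimum distance $4$. -}

module Defs where

open import Data.Bool using (Bool; true; false; _xor_; _∧_)
open import Data.Nat using (ℕ; zero; suc; _≤_)
open import Data.Nat.Divisibility using (_∣_)
open import Data.Fin using (Fin)
open import Data.Fin.Permutation using (Permutation′; _⟨$⟩ˡ_)
open import Data.Vec using (Vec; []; _∷_; _++_; lookup; tabulate; zipWith; foldr′)
open import Data.List using (List; length)
open import Data.List.Relation.Unary.All using (All)
open import Data.List.Relation.Unary.Any using (Any)
open import Data.List.Relation.Unary.AllPairs using (AllPairs)
open import Data.Product using (Σ; ∃; ∃₂; _×_)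
open import Data.Empty using (⊥)
open import Relation.Nullary using (¬_)
open import Relation.Binary.PropositionalEquality using (_≡_; _≢_)
open import Function using (_∘_; id)

Word : ℕ → Set
Word n = Vec Bool n

weight : ∀ {n} → Word n → ℕ
weight [] = 0
weight (true ∷ x) = suc (weight x)
weight (false ∷ x) = weight x

dist : ∀ {n} → Word n → Word n → ℕ
dist x y = weight (zipWith _xor_ x y)

Even : ∀ {n} → Word n → Set
Even x = 2 ∣ weight x

-- a code: a subset of 𝔼ⁿ, given as a predicate on words (IsCode says ⊆ 𝔼ⁿ)
Code : ℕ → Set₁
Code n = Word n → Set

IsCode : ∀ {n} → Code n → Set
IsCode C = ∀ x → C x → Even x

MinDist≥ : ∀ {n} → ℕ → Code n → Set
MinDist≥ d C = ∀ x y → C x → C y → x ≢ y → d ≤ dist x y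

_≐_ : ∀ {n} → Code n → Code n → Set
C ≐ D = (∀ x → C x → D x) × (∀ x → D x → C x)

-- maps 𝔼ⁿ → 𝔼ⁿ (represented by maps on all words; only values on 𝔼ⁿ matter)
Map : ℕ → Set
Map n = Word n → Word n

_≈_ : ∀ {n} → Map n → Map n → Set
f ≈ g = ∀ x → Even x → f x ≡ g x

-- coordinate permutation: (π x)_j = x_{π⁻¹(j)}, i.e. coordinate i moves to π(i)
permute : ∀ {n} → Permutation′ n → Word n → Word n
permute π x = tabulate (λ j → lookup x (π ⟨$⟩ˡ j))

gmap : ∀ {n} → Permutation′ n → Word n → Map n
gmap π c x = zipWith _xor_ (permute π x) c

IsG : ∀ {n} → Map n → Set
IsG {n} f = Σ (Permutation′ n) λ π → Σ (Word n) λ c → Even c × f ≈ gmap π c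

image : ∀ {n} → Map n → Code n → Code n
image f C y = ∃ λ x → C x × f x ≡ y

InAut : ∀ {n} → Code n → Map n → Set
InAut C f = IsG f × image f C ≐ C

InAutFam : ∀ {n k} → (Fin k → Code n) → Map n → Set
InAutFam {k = k} 𝒞 f =
  IsG f
  × (∀ i → Σ (Fin k) λ j → image f (𝒞 i) ≐ 𝒞 j)
  × (∀ j → Σ (Fin k) λ i → 𝒞 j ≐ image f (𝒞 i))

IsPartition : ∀ {n k} → (Fin k → Code n) → Set
IsPartition {n} {k} 𝒞 =
  (∀ i → IsCode (𝒞 i))
  × (∀ i → ∃ λ x → 𝒞 i x)
  × (∀ (i j : Fin k) (x : Word n) → i ≢ j → 𝒞 i x → 𝒞 j x → ⊥)
  × (∀ (x : Word n) → Even x → ∃ λ i → 𝒞 i x)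

Equivalent : ∀ {n} → Code n → Code n → Set
Equivalent {n} C D = ∃ λ (f : Map n) → IsG f × image f D ≐ C

_∈ₘ_ : ∀ {n} → Map n → List (Map n) → Set
f ∈ₘ L = Any (λ g → f ≈ g) L

Distinct : ∀ {n} → List (Map n) → Set
Distinct L = AllPairs (λ f g → ¬ (f ≈ g)) L

AtLeast : ∀ {n} → ℕ → (Map n → Set) → Set
AtLeast {n} k S = ∃ λ (L : List (Map n)) → length L ≡ k × All S L × Distinct L

-- the (duplicate-free) list H is a subgroup of the group S (under composition);
-- its order is then length H
IsSubgroupOf : ∀ {n} → (Map n → Set) → List (Map n) → Set
IsSubgroupOf S H =
  All S H
  × Distinct H
  × id ∈ₘ H
  × All (λ f → All (λ g → (f ∘ g) ∈ₘ H) H) H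
  × All (λ f → Any (λ g → (f ∘ g) ≈ id) H) H

-- Hamming code of length 7: null space of the 3×7 matrix whose j-th column
-- (j = 1..7) is the binary expansion of j
Hmat : Vec (Vec Bool 7) 3
Hmat = (true  ∷ false ∷ true  ∷ false ∷ true  ∷ false ∷ true  ∷ [])
     ∷ (false ∷ true  ∷ true  ∷ false ∷ false ∷ true  ∷ true  ∷ [])
     ∷ (false ∷ false ∷ false ∷ true  ∷ true  ∷ true  ∷ true  ∷ [])
     ∷ []

dot : ∀ {n} → Vec Bool n → Vec Bool n → Bool
dot u v = foldr′ _xor_ false (zipWith _∧_ u v)

parity : ∀ {n} → Vec Bool n → Bool
parity v = foldr′ _xor_ false v

Hamming7 : Vec Bool 7 → Set
Hamming7 y = ∀ (r : Fin 3) → dot (lookup Hmat r) y ≡ false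

DoublyExtHamming : Code 9
DoublyExtHamming x = ∃ λ (y : Vec Bool 7) → Hamming7 y × x ≡ y ++ (parity y ∷ false ∷ [])

{-# OPTIONS --safe #-}

-- Every element of G_9 has order dividing 5040 = 2 · lcm(1, …, 9), so a nontrivial element has a
-- power of prime order 2, 3, 5 or 7. Since 13 is divisible by none of these primes, a subgroup of
-- order 3, 5, 7 or 4 of Aut(𝒞) fixes one of the 13 codes. If Aut(𝒞) has at least three elements,
-- take g ≠ h nontrivial: either one of g, h, gh has a power of odd prime order or of order 4, or
-- these three are involutions and form a Klein four-group; this is (ii).
-- For (i), a code in 𝔼⁹ of minimum distance 4 has at most 20 words. As 16 + 16 + 11 · 20 < 256,
-- at most one code of the partition has 16 words, so Aut(𝒞) fixes the given Hamming code and any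
-- subgroup of prime order will do.
-- The bound 20 is Plotkin's bound after adjoining to each word all sums of two of its coordinates:
-- distances 4, 6, 8 become 24, 24, 16 in length 45, and at most one codeword is at distance 8 from
-- a given one. For 21 codewords the sum of all distances is thus at least 21 · (24 · 20 − 8) = 9912,
-- whereas each of the 45 columns contributes at most 2 · 10 · 11 to it, giving at most 9900.

module Submission where

open import Defs
open import Data.Bool using (Bool; true; false; not; _xor_; T)
open import Data.Bool.Properties as Bool using (xor-assoc; xor-same; xor-identityʳ)
open import Data.Nat
  using (ℕ; zero; suc; _+_; _*_; _∸_; _≤_; _<_; _≟_; _≤?_; _≡ᵇ_; z≤n; s≤s;
    NonZero; >-nonZero⁻¹; _%_; _/_)
open import Data.Nat.Properties
open import Data.Nat.Divisibility
open import Data.Nat.DivMod using (m≡m%n+[m/n]*n; m%n<n)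
open import Data.Nat.GCD using (module Bézout)
open import Data.Nat.Coprimality using (Coprime; coprime-Bézout; prime⇒coprime)
open import Data.Nat.Primality using (Prime; prime?; prime⇒nonZero; prime[2])
open import Data.Nat.GeneralisedArithmetic using (fold; fold-+)
open import Data.Nat.ListAction using (sum; product)
open import Data.Nat.Tactic.RingSolver using (solve-∀)
open import Data.Fin using (Fin; toℕ; fromℕ<)
open import Data.Fin.Properties as Fin using (injective⇒≤; toℕ-fromℕ<; pigeonhole; toℕ<n)
open import Data.Fin.Permutation as Perm using (Permutation′; _⟨$⟩ˡ_; _⟨$⟩ʳ_; _∘ₚ_; inverseʳ)
open import Data.Vec as Vec using ([]; _∷_; zipWith; tabulate)
open import Data.Vec.Properties as Vec
  using (zipWith-++; zipWith-assoc; zipWith-identityʳ; lookup∘tabulate; tabulate∘lookup; tabulate-cong; lookup-zipWith)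
import Algebra.Properties.CommutativeMonoid.Sum +-0-commutativeMonoid as Sum
open import Data.List as List using (List; []; _∷_; map; length; filter; applyUpTo; allFin; concatMap)
open import Data.List.Properties
  using (length-map; map-∘; map-cong; length-take; length-++; length-applyUpTo; length-tabulate)
open import Data.List.Membership.Propositional using (_∈_; _∉_)
open import Data.List.Membership.Propositional.Properties
import Data.List.Membership.DecPropositional as DecMembership
open import Data.List.Relation.Unary.Any as Any using (Any; here; there)
import Data.List.Relation.Unary.Any.Properties as Any
open import Data.List.Relation.Unary.All as All using (All; []; _∷_)
import Data.List.Relation.Unary.All.Properties as All
open import Data.List.Relation.Unary.AllPairs using ([]; _∷_)
import Data.List.Relation.Unary.AllPairs.Properties as AllPairs
open import Data.List.Relation.Unary.Unique.Propositional using (Unique)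
import Data.List.Relation.Unary.Unique.Propositional.Properties as Unique
open import Data.List.Relation.Binary.Subset.Propositional using (_⊆_)
open import Data.Product using (_×_; _,_; proj₁; proj₂; ∃; ∃₂)
open import Data.Sum using (_⊎_; inj₁; inj₂)
open import Data.Empty using (⊥; ⊥-elim)
open import Function using (_∘_; id)
open import Relation.Nullary using (¬_; Dec; yes; no; contradiction; ¬?)
open import Relation.Nullary.Decidable using (map′; _×-dec_; _→-dec_; from-yes; from-no)
open import Relation.Unary using (Decidable)
open import Relation.Binary using (DecidableEquality)
open import Relation.Binary.PropositionalEquality

-- Binary words and their enumeration.

infixl 6 _⊕_
_⊕_ : ∀ {n} → Word n → Word n → Word n
_⊕_ = zipWith _xor_

0ʷ : ∀ {n} → Word n
0ʷ = Vec.replicate _ false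

_≟ʷ_ : ∀ {n} (x y : Word n) → Dec (x ≡ y)
_≟ʷ_ = Vec.≡-dec Bool._≟_

-- Turns claims about all words of a fixed length into computations; it also makes equality of maps
-- on the even words decidable.
∀word? : ∀ n {P : Word n → Set} → (∀ x → Dec (P x)) → Dec (∀ x → P x)
∀word? zero P? = map′ (λ { p [] → p }) (λ p → p []) (P? [])
∀word? (suc n) P? =
  map′ (λ { (t , f) (true ∷ x) → t x ; (t , f) (false ∷ x) → f x })
       (λ p → (p ∘ (true ∷_)) , (p ∘ (false ∷_)))
       (∀word? n (P? ∘ (true ∷_)) ×-dec ∀word? n (P? ∘ (false ∷_)))

even? : ∀ {n} (x : Word n) → Dec (Even x)
even? x = 2 ∣? weight x

words : ∀ n → List (Word n)
words zero = [] ∷ []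
words (suc n) = map (true ∷_) (words n) List.++ map (false ∷_) (words n)

words-complete : ∀ {n} (x : Word n) → x ∈ words n
words-complete [] = here refl
words-complete (true ∷ x) = ∈-++⁺ˡ (∈-map⁺ (true ∷_) (words-complete x))
words-complete (false ∷ x) = ∈-++⁺ʳ (map (true ∷_) (words _)) (∈-map⁺ (false ∷_) (words-complete x))

words-unique : ∀ n → Unique (words n)
words-unique zero = [] ∷ []
words-unique (suc n) =
  Unique.++⁺ (Unique.map⁺ Vec.∷-injectiveʳ (words-unique n))
             (Unique.map⁺ Vec.∷-injectiveʳ (words-unique n))
             disjoint
  where
  disjoint : ∀ {x} → ¬ (x ∈ map (true ∷_) (words n) × x ∈ map (false ∷_) (words n))
  disjoint (p , q) with ∈-map⁻ (true ∷_) p | ∈-map⁻ (false ∷_) q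
  ... | _ , _ , refl | _ , _ , ()

-- Lists without repetitions.

module _ {A : Set} where

  lookup-injective : ∀ {xs : List A} → Unique xs →
    ∀ i j → List.lookup xs i ≡ List.lookup xs j → i ≡ j
  lookup-injective (_ ∷ _) Fin.zero Fin.zero _ = refl
  lookup-injective (x∉ ∷ _) Fin.zero (Fin.suc j) eq = contradiction eq (All.lookup x∉ (∈-lookup j))
  lookup-injective (x∉ ∷ _) (Fin.suc i) Fin.zero eq = contradiction (sym eq) (All.lookup x∉ (∈-lookup i))
  lookup-injective (_ ∷ u) (Fin.suc i) (Fin.suc j) eq = cong Fin.suc (lookup-injective u i j eq)

  -- Sending a position in `xs` to a position of the same element in `ys` is injective, as `xs` has
  -- no repetitions. Cardinalities are compared through this.
  unique-⊆⇒length≤ : ∀ {xs ys : List A} → Unique xs → xs ⊆ ys → length xs ≤ length ys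
  unique-⊆⇒length≤ {xs} {ys} u xs⊆ys = injective⇒≤ {f = f} f-injective
    where
    f : Fin (length xs) → Fin (length ys)
    f i = Any.index (xs⊆ys (∈-lookup i))

    f-injective : ∀ {i j} → f i ≡ f j → i ≡ j
    f-injective {i} {j} eq = lookup-injective u i j (begin
      List.lookup xs i       ≡⟨ Any.lookup-index (xs⊆ys (∈-lookup i)) ⟩
      List.lookup ys (f i)   ≡⟨ cong (List.lookup ys) eq ⟩
      List.lookup ys (f j)   ≡⟨ Any.lookup-index (xs⊆ys (∈-lookup j)) ⟨
      List.lookup xs j       ∎)
      where open ≡-Reasoning

-- Addition, weight and distance of words.

⊕-assoc : ∀ {n} (x y z : Word n) → x ⊕ y ⊕ z ≡ x ⊕ (y ⊕ z)
⊕-assoc = zipWith-assoc xor-assoc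

⊕-identityʳ : ∀ {n} (x : Word n) → x ⊕ 0ʷ ≡ x
⊕-identityʳ = zipWith-identityʳ xor-identityʳ

⊕-self : ∀ {n} (x : Word n) → x ⊕ x ≡ 0ʷ
⊕-self [] = refl
⊕-self (a ∷ x) = cong₂ _∷_ (xor-same a) (⊕-self x)

-- Thus `dist (x ⊕ y) (x ⊕ z)` is `dist y z`: two codewords can be compared through their
-- differences from a third.
⊕-cancel : ∀ {n} (x y z : Word n) → (x ⊕ y) ⊕ (x ⊕ z) ≡ y ⊕ z
⊕-cancel [] [] [] = refl
⊕-cancel (a ∷ x) (b ∷ y) (c ∷ z) = cong₂ _∷_ (cancel a b c) (⊕-cancel x y z)
  where
  cancel : ∀ a b c → (a xor b) xor (a xor c) ≡ b xor c
  cancel false b c = refl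
  cancel true false c = Bool.not-involutive c
  cancel true true c = refl

bit : Bool → ℕ
bit true = 1
bit false = 0

weight-∷ : ∀ {n} b (x : Word n) → weight (b ∷ x) ≡ bit b + weight x
weight-∷ true x = refl
weight-∷ false x = refl

-- The weights of `x` and `y` add up to that of `x ⊕ y` plus twice the number of common ones, which
-- is the `k` of `common`.
even-⊕ : ∀ {n} {x y : Word n} → Even x → Even y → Even (x ⊕ y)
even-⊕ {x = x} {y} 2∣x 2∣y =
  ∣m+n∣m⇒∣n (subst (2 ∣_) (proj₂ (common x y)) (∣m∣n⇒∣m+n 2∣x 2∣y)) (m∣m*n (proj₁ (common x y)))
  where
  common : ∀ {n} (x y : Word n) → ∃ λ k → weight x + weight y ≡ 2 * k + weight (x ⊕ y)
  common [] [] = 0 , refl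
  common (a ∷ x) (b ∷ y) with common x y
  common (false ∷ x) (false ∷ y) | k , eq = k , eq
  common (false ∷ x) (true ∷ y) | k , eq =
    k , trans (+-suc (weight x) _) (trans (cong suc eq) (sym (+-suc (2 * k) _)))
  common (true ∷ x) (false ∷ y) | k , eq = k , trans (cong suc eq) (sym (+-suc (2 * k) _))
  common (true ∷ x) (true ∷ y) | k , eq = suc k , (begin
    suc (weight x + suc (weight y))       ≡⟨ cong suc (+-suc (weight x) _) ⟩
    2 + (weight x + weight y)             ≡⟨ cong (2 +_) eq ⟩
    2 + (2 * k + weight (x ⊕ y))          ≡⟨ cong (_+ weight (x ⊕ y)) (sym (*-suc 2 k)) ⟩
    2 * suc k + weight (x ⊕ y)            ∎)
    where open ≡-Reasoning

-- Either none or exactly two of `a`, `b` and `a xor b` are true, so each coordinate contributes at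
-- most 2. Two heavy words are therefore close to each other.
dist+weights≤ : ∀ {n} (x y : Word n) → dist x y + (weight x + weight y) ≤ 2 * n
dist+weights≤ [] [] = z≤n
dist+weights≤ {suc n} (a ∷ x) (b ∷ y) =
  subst (dist (a ∷ x) (b ∷ y) + (weight (a ∷ x) + weight (b ∷ y)) ≤_) (sym (*-suc 2 n))
    (step a b (dist+weights≤ x y))
  where
  d = dist x y
  v = weight x
  w = weight y

  shiftʳ : d + (v + suc w) ≡ suc (d + (v + w))
  shiftʳ = trans (cong (d +_) (+-suc v w)) (+-suc d (v + w))

  step : ∀ a b → d + (v + w) ≤ 2 * n →
    dist (a ∷ x) (b ∷ y) + (weight (a ∷ x) + weight (b ∷ y)) ≤ 2 + 2 * n
  step false false p = m≤n⇒m≤1+n (m≤n⇒m≤1+n p)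
  step false true p = s≤s (≤-trans (≤-reflexive shiftʳ) (s≤s p))
  step true false p = s≤s (≤-trans (≤-reflexive (+-suc d (v + w))) (s≤s p))
  step true true p =
    ≤-trans (≤-reflexive (trans (+-suc d (v + suc w)) (cong suc shiftʳ))) (s≤s (s≤s p))

-- Adjoining the sums of two coordinates.

triangle : ℕ → ℕ
triangle zero = 0
triangle (suc n) = n + triangle n

-- There is one entry per pair of coordinates, and `triangle n` is the binomial coefficient `n` over
-- 2. For `n = 9` the embedded length is 9 + 36 = 45.
pairs : ∀ {n} → Word n → Word (triangle n)
pairs [] = []
pairs (a ∷ x) = Vec.map (a xor_) x Vec.++ pairs x

embed : ∀ {n} → Word n → Word (n + triangle n)
embed x = x Vec.++ pairs x

-- All entries of `embed x` are linear in `x`. So the distance of two embedded words depends only on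
-- their difference, and a check over single words suffices.
embed-⊕ : ∀ {n} (x y : Word n) → embed x ⊕ embed y ≡ embed (x ⊕ y)
embed-⊕ x y = trans (zipWith-++ _xor_ x _ y _) (cong (x ⊕ y Vec.++_) (pairs-⊕ x y))
  where
  interchange : ∀ a b c d → (a xor c) xor (b xor d) ≡ (a xor b) xor (c xor d)
  interchange false false c d = refl
  interchange false true c d = sym (Bool.not-distribʳ-xor c d)
  interchange true false c d = sym (Bool.not-distribˡ-xor c d)
  interchange true true c d = trans (sym (Bool.not-distribˡ-xor c (not d)))
    (trans (cong not (sym (Bool.not-distribʳ-xor c d))) (Bool.not-involutive _))

  map-xor-⊕ : ∀ {n} a b (x y : Word n) →
    Vec.map (a xor_) x ⊕ Vec.map (b xor_) y ≡ Vec.map ((a xor b) xor_) (x ⊕ y)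
  map-xor-⊕ a b [] [] = refl
  map-xor-⊕ a b (c ∷ x) (d ∷ y) = cong₂ _∷_ (interchange a b c d) (map-xor-⊕ a b x y)

  pairs-⊕ : ∀ {n} (x y : Word n) → pairs x ⊕ pairs y ≡ pairs (x ⊕ y)
  pairs-⊕ [] [] = refl
  pairs-⊕ (a ∷ x) (b ∷ y) =
    trans (zipWith-++ _xor_ (Vec.map (a xor_) x) _ (Vec.map (b xor_) y) _)
          (cong₂ Vec._++_ (map-xor-⊕ a b x y) (pairs-⊕ x y))

-- Finite sums over lists.

∑ : {A : Set} → List A → (A → ℕ) → ℕ
∑ L f = sum (map f L)

module _ {A : Set} where

  ∑-cong : ∀ (L : List A) {f g : A → ℕ} → (∀ x → f x ≡ g x) → ∑ L f ≡ ∑ L g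
  ∑-cong L eq = cong sum (map-cong eq L)

  ∑-map : ∀ {B : Set} (h : A → B) (L : List A) (f : B → ℕ) → ∑ (map h L) f ≡ ∑ L (f ∘ h)
  ∑-map h L f = cong sum (sym (map-∘ L))

  ∑-+ : ∀ (L : List A) (f g : A → ℕ) → ∑ L (λ x → f x + g x) ≡ ∑ L f + ∑ L g
  ∑-+ [] f g = refl
  ∑-+ (x ∷ L) f g = trans (cong (f x + g x +_) (∑-+ L f g)) (middle-swap (f x) (g x) _ _)
    where
    middle-swap : ∀ a b c d → a + b + (c + d) ≡ a + c + (b + d)
    middle-swap = solve-∀

  ∑-* : ∀ (L : List A) c (f : A → ℕ) → ∑ L (λ x → c * f x) ≡ c * ∑ L f
  ∑-* [] c f = sym (*-zeroʳ c)
  ∑-* (x ∷ L) c f = trans (cong (c * f x +_) (∑-* L c f)) (sym (*-distribˡ-+ c (f x) _))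

  ∑-lower : ∀ (L : List A) c {f : A → ℕ} → All (λ x → c ≤ f x) L → length L * c ≤ ∑ L f
  ∑-lower [] c [] = z≤n
  ∑-lower (x ∷ L) c (p ∷ ps) = +-mono-≤ p (∑-lower L c ps)

  ∑-upper : ∀ (L : List A) c {f : A → ℕ} → All (λ x → f x ≤ c) L → ∑ L f ≤ length L * c
  ∑-upper [] c [] = z≤n
  ∑-upper (x ∷ L) c (p ∷ ps) = +-mono-≤ p (∑-upper L c ps)

  -- After the first entry at which `f` is true, a second one would equal it by `inj` and contradict
  -- uniqueness.
  ∑-bit≤1 : ∀ {L : List A} (f : A → Bool) → Unique L →
    (∀ {x y} → x ∈ L → y ∈ L → f x ≡ true → f y ≡ true → x ≡ y) → ∑ L (bit ∘ f) ≤ 1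
  ∑-bit≤1 {[]} f [] inj = z≤n
  ∑-bit≤1 {x ∷ L} f (x∉ ∷ u) inj with f x in fx
  ... | false = ∑-bit≤1 f u (λ p q → inj (there p) (there q))
  ... | true = s≤s (≤-trans (∑-upper L 0 (All.tabulate zero′)) (≤-reflexive (*-zeroʳ (length L))))
    where
    zero′ : ∀ {y} → y ∈ L → bit (f y) ≤ 0
    zero′ {y} y∈ with f y in fy
    ... | false = z≤n
    ... | true = contradiction (inj (here refl) (there y∈) fx fy) (All.lookup x∉ y∈)

-- Counts the entries that differ from `b`, so `count true` counts zeros and `count false` counts
-- ones. This is what an entry `b` of a column adds to the sum of distances.
count : Bool → List Bool → ℕ
count b bs = ∑ bs (λ c → bit (b xor c))

count-length : ∀ bs → count true bs + count false bs ≡ length bs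
count-length [] = refl
count-length (true ∷ bs) = trans (+-suc _ _) (cong suc (count-length bs))
count-length (false ∷ bs) = cong suc (count-length bs)

∑-count : ∀ bs (f : Bool → ℕ) → ∑ bs f ≡ count false bs * f true + count true bs * f false
∑-count [] f = refl
∑-count (true ∷ bs) f = trans (cong (f true +_) (∑-count bs f)) (sym (+-assoc (f true) _ _))
∑-count (false ∷ bs) f = trans (cong (f false +_) (∑-count bs f)) (swap (f false) (count false bs * f true) _)
  where
  swap : ∀ a b c → a + (b + c) ≡ b + (a + c)
  swap = solve-∀

-- The Plotkin bound and the constants of its application.

total-dist : ∀ {m} → List (Word m) → ℕ
total-dist L = ∑ L λ x → ∑ L (dist x)

-- A column with k ones and l zeros contributes 2kl to the sum of distances.
plotkin : ∀ m (L : List (Word m)) c → (∀ k l → k + l ≡ length L → 2 * (k * l) ≤ c) →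
  total-dist L ≤ m * c
plotkin zero L c h = ≤-trans (∑-upper L 0 (All.tabulate λ {x} _ → inner x)) (≤-reflexive (*-zeroʳ (length L)))
  where
  inner : ∀ x → ∑ L (dist x) ≤ 0
  inner [] = ≤-trans (∑-upper L 0 (All.tabulate λ { {[]} _ → z≤n })) (≤-reflexive (*-zeroʳ (length L)))
plotkin (suc m) L c h = begin
  total-dist L
    ≡⟨ ∑-cong L (λ x → trans (∑-cong L (dist-split x)) (∑-+ L _ _)) ⟩
  ∑ L (λ x → ∑ L (λ y → bit (Vec.head x xor Vec.head y)) + ∑ L (λ y → dist (Vec.tail x) (Vec.tail y)))
    ≡⟨ ∑-+ L _ _ ⟩
  ∑ L (λ x → ∑ L (λ y → bit (Vec.head x xor Vec.head y)))
    + ∑ L (λ x → ∑ L (λ y → dist (Vec.tail x) (Vec.tail y)))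
    ≡⟨ cong₂ _+_ (∑-cong L λ x → ∑-map Vec.head L _) (∑-cong L λ x → ∑-map Vec.tail L _) ⟨
  ∑ L (λ x → count (Vec.head x) heads) + ∑ L (λ x → ∑ tails (dist (Vec.tail x)))
    ≡⟨ cong₂ _+_ (∑-map Vec.head L _) (∑-map Vec.tail L _) ⟨
  ∑ heads (λ a → count a heads) + total-dist tails
    ≤⟨ +-mono-≤ column (plotkin m tails c λ k l eq → h k l (trans eq (length-map Vec.tail L))) ⟩
  c + m * c ∎
  where
  open ≤-Reasoning
  heads = map Vec.head L
  tails = map Vec.tail L

  dist-split : ∀ (x y : Word (suc m)) →
    dist x y ≡ bit (Vec.head x xor Vec.head y) + dist (Vec.tail x) (Vec.tail y)
  dist-split (a ∷ x) (b ∷ y) = weight-∷ (a xor b) (x ⊕ y)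

  double : ∀ k l → k * l + l * k ≡ 2 * (l * k)
  double = solve-∀

  column : ∑ heads (λ a → count a heads) ≤ c
  column = begin
    ∑ heads (λ a → count a heads)
      ≡⟨ ∑-count heads _ ⟩
    count false heads * count true heads + count true heads * count false heads
      ≡⟨ double (count false heads) _ ⟩
    2 * (count true heads * count false heads)
      ≤⟨ h (count true heads) (count false heads) (trans (count-length heads) (length-map Vec.head L)) ⟩
    c ∎

-- The last two terms make up for z = 0 and for weight 8, where embed z has weight 0 and 16.
embed-weight : ∀ (z : Word 9) → Even z → weight z ≢ 2 →
  24 ≤ weight (embed z) + 24 * bit (weight z ≡ᵇ 0) + 8 * bit (weight z ≡ᵇ 8)
embed-weight = from-yes (∀word? 9 λ z → even? z →-dec (¬? (weight z ≟ 2) →-dec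
  (24 ≤? weight (embed z) + 24 * bit (weight z ≡ᵇ 0) + 8 * bit (weight z ≡ᵇ 8))))

-- The maximum is attained at 10 and 11, where it is 2 · 110; the 22 possible values of `k` are
-- checked one by one.
product-bound-21 : ∀ k l → k + l ≡ 21 → 2 * (k * l) ≤ 220
product-bound-21 k l eq = subst₂ (λ k l → 2 * (k * l) ≤ 220) (toℕ-fromℕ< k<22) l-eq (table (fromℕ< k<22))
  where
  k<22 : k < 22
  k<22 = s≤s (subst (k ≤_) eq (m≤m+n k l))
  l-eq : 21 ∸ toℕ (fromℕ< k<22) ≡ l
  l-eq rewrite toℕ-fromℕ< k<22 | sym eq = m+n∸m≡n k l
  table : ∀ (i : Fin 22) → 2 * (toℕ i * (21 ∸ toℕ i)) ≤ 220
  table = from-yes (Fin.all? {n = 22} λ i → 2 * (toℕ i * (21 ∸ toℕ i)) ≤? 220)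

-- The size of an even code of length 9 and minimum distance 4.

module _ {C : Code 9} (isCode : IsCode C) (minDist : MinDist≥ 4 C) where

  module _ {L : List (Word 9)} (unique : Unique L) (L⊆C : ∀ {x} → x ∈ L → C x) where

    close⇒≡ : ∀ {x y} → x ∈ L → y ∈ L → dist x y < 4 → x ≡ y
    close⇒≡ {x} {y} x∈ y∈ d<4 with x ≟ʷ y
    ... | yes eq = eq
    ... | no x≢y = contradiction (minDist x y (L⊆C x∈) (L⊆C y∈) x≢y) (<⇒≱ d<4)

    -- For `y` and `z` at distance `d` from `x`, `dist+weights≤` applied to `x ⊕ y` and `x ⊕ z`
    -- gives `dist y z + 2d ≤ 18`. As `2d ≥ 15`, they are closer than 4 and coincide.
    at-distance : ∀ x d → 15 ≤ d + d → ∑ L (λ y → bit (dist x y ≡ᵇ d)) ≤ 1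
    at-distance x d 15≤ = ∑-bit≤1 (λ y → dist x y ≡ᵇ d) unique λ {y} {z} y∈ z∈ fy fz →
      close⇒≡ y∈ z∈ (near (≡ᵇ⇒≡ _ d (subst T (sym fy) _)) (≡ᵇ⇒≡ _ d (subst T (sym fz) _)))
      where
      near : ∀ {y z} → dist x y ≡ d → dist x z ≡ d → dist y z < 4
      near {y} {z} p q = s≤s (+-cancelʳ-≤ 15 _ 3 (begin
        dist y z + 15                                    ≤⟨ +-monoʳ-≤ (dist y z) 15≤ ⟩
        dist y z + (d + d)                               ≡⟨ cong₂ _+_ (cong weight (⊕-cancel x y z)) (cong₂ _+_ p q) ⟨
        dist (x ⊕ y) (x ⊕ z) + (dist x y + dist x z)     ≤⟨ dist+weights≤ (x ⊕ y) (x ⊕ z) ⟩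
        18 ∎))
        where open ≤-Reasoning

    at-distance-0 : ∀ {x} → x ∈ L → ∑ L (λ y → bit (dist x y ≡ᵇ 0)) ≤ 1
    at-distance-0 {x} x∈ = ∑-bit≤1 (λ y → dist x y ≡ᵇ 0) unique λ {y} {z} y∈ z∈ fy fz →
      trans (sym (same y∈ fy)) (same z∈ fz)
      where
      same : ∀ {y} → y ∈ L → (dist x y ≡ᵇ 0) ≡ true → x ≡ y
      same {y} y∈ fy = close⇒≡ x∈ y∈
        (subst (_< 4) (sym (≡ᵇ⇒≡ (dist x y) 0 (subst T (sym fy) _))) (s≤s z≤n))

    embedded-distance : ∀ {x y} → x ∈ L → y ∈ L →
      24 ≤ dist (embed x) (embed y) + 24 * bit (dist x y ≡ᵇ 0) + 8 * bit (dist x y ≡ᵇ 8)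
    embedded-distance {x} {y} x∈ y∈ =
      subst (λ v → 24 ≤ weight v + 24 * bit (dist x y ≡ᵇ 0) + 8 * bit (dist x y ≡ᵇ 8))
        (sym (embed-⊕ x y))
        (embed-weight (x ⊕ y) (even-⊕ {x = x} {y} (isCode x (L⊆C x∈)) (isCode y (L⊆C y∈))) ≢2)
      where
      ≢2 : dist x y ≢ 2
      ≢2 eq with close⇒≡ x∈ y∈ (subst (_< 4) (sym eq) (s≤s (s≤s (s≤s z≤n))))
      ... | refl = contradiction (trans (sym eq) (cong weight (⊕-self x))) λ ()

    -- Summing `embedded-distance` over `y`, the correction 24 occurs for `y = x` alone and the
    -- correction 8 for at most one word, so together they are at most 32.
    row-sum : ∀ {x} → x ∈ L → length L * 24 ≤ ∑ L (λ y → dist (embed x) (embed y)) + 32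
    row-sum {x} x∈ = begin
      length L * 24
        ≤⟨ ∑-lower L 24 (All.tabulate (embedded-distance x∈)) ⟩
      ∑ L (λ y → D y + 24 * Z y + 8 * E y)
        ≡⟨ trans (∑-+ L _ _) (cong₂ _+_ (∑-+ L D _) (∑-* L 8 E)) ⟩
      ∑ L D + ∑ L (λ y → 24 * Z y) + 8 * ∑ L E
        ≡⟨ cong (λ s → ∑ L D + s + 8 * ∑ L E) (∑-* L 24 Z) ⟩
      ∑ L D + 24 * ∑ L Z + 8 * ∑ L E
        ≤⟨ +-mono-≤ (+-monoʳ-≤ (∑ L D) (*-monoʳ-≤ 24 (at-distance-0 x∈)))
                    (*-monoʳ-≤ 8 (at-distance x 8 (from-yes (15 ≤? 16)))) ⟩
      ∑ L D + 24 + 8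
        ≡⟨ +-assoc (∑ L D) 24 8 ⟩
      ∑ L D + 32 ∎
      where
      open ≤-Reasoning
      D Z E : Word 9 → ℕ
      D y = dist (embed x) (embed y)
      Z y = bit (dist x y ≡ᵇ 0)
      E y = bit (dist x y ≡ᵇ 8)

    length≢21 : length L ≢ 21
    length≢21 l≡21 = contradiction (≤-trans lower upper) (from-no (9912 ≤? 9900))
      where
      -- 472 = 21 · 24 - 32.
      rows : ∀ {x} → x ∈ L → 472 ≤ ∑ L (λ y → dist (embed x) (embed y))
      rows {x} x∈ = +-cancelʳ-≤ 32 472 _
        (subst (λ l → l * 24 ≤ ∑ L (λ y → dist (embed x) (embed y)) + 32) l≡21 (row-sum x∈))
      lower : 9912 ≤ total-dist (map embed L)
      lower = begin
        21 * 472                                           ≡⟨ cong (λ l → l * 472) l≡21 ⟨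
        length L * 472                                     ≤⟨ ∑-lower L 472 (All.tabulate rows) ⟩
        ∑ L (λ x → ∑ L (λ y → dist (embed x) (embed y)))   ≡⟨ ∑-cong L (λ x → ∑-map embed L _) ⟨
        ∑ L (λ x → ∑ (map embed L) (dist (embed x)))       ≡⟨ ∑-map embed L _ ⟨
        total-dist (map embed L)                           ∎
        where open ≤-Reasoning
      upper : total-dist (map embed L) ≤ 9900
      -- There are 45 columns, each contributing at most 220.
      upper = plotkin 45 (map embed L) 220 λ k l eq →
        product-bound-21 k l (trans eq (trans (length-map embed L) l≡21))

  -- The first 21 words of a longer list would contradict `length≢21`.
  code-size≤20 : ∀ {L} → Unique L → (∀ {x} → x ∈ L → C x) → length L ≤ 20
  code-size≤20 {L} unique L⊆C = ≮⇒≥ λ 20<l →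
    length≢21 (Unique.take⁺ 21 unique) (L⊆C ∘ ∈-take) (trans (length-take 21 L) (m≤n⇒m⊓n≡m 20<l))
    where
    ∈-take : ∀ {x} → x ∈ List.take 21 L → x ∈ L
    ∈-take = All.lookup (All.take⁺ 21 (All.tabulate {xs = L} (λ x∈ → x∈)))

-- Iterates and periods.

infix 30 _^^_
_^^_ : {A : Set} → (A → A) → ℕ → A → A
(f ^^ k) x = fold x f k

module _ {A : Set} (f : A → A) where

  ^^-+ : ∀ m n x → (f ^^ (m + n)) x ≡ (f ^^ m) ((f ^^ n) x)
  ^^-+ m n x = fold-+ x f m

  ^^-* : ∀ m n x → ((f ^^ n) ^^ m) x ≡ (f ^^ (m * n)) x
  ^^-* zero n x = refl
  ^^-* (suc m) n x = trans (cong (f ^^ n) (^^-* m n x)) (sym (^^-+ n (m * n) x))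

  ^^-suc : ∀ k x → (f ^^ k) (f x) ≡ f ((f ^^ k) x)
  ^^-suc zero x = refl
  ^^-suc (suc k) x = cong f (^^-suc k x)

  fixed-^^ : ∀ {x} → f x ≡ x → ∀ k → (f ^^ k) x ≡ x
  fixed-^^ eq zero = refl
  fixed-^^ eq (suc k) = trans (cong f (fixed-^^ eq k)) eq

module _ {A : Set} {f : A → A} {x : A} where

  period-* : ∀ {p} → (f ^^ p) x ≡ x → ∀ m → (f ^^ (m * p)) x ≡ x
  period-* {p} eq m = trans (sym (^^-* f m p x)) (fixed-^^ (f ^^ p) eq m)

  period-∣ : ∀ {p n} → (f ^^ p) x ≡ x → p ∣ n → (f ^^ n) x ≡ x
  period-∣ eq (divides m refl) = period-* eq m

  period-% : ∀ {p} .{{_ : NonZero p}} → (f ^^ p) x ≡ x → ∀ m → (f ^^ m) x ≡ (f ^^ (m % p)) x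
  period-% {p} eq m = begin
    (f ^^ m) x                             ≡⟨ cong (λ k → (f ^^ k) x) (m≡m%n+[m/n]*n m p) ⟩
    (f ^^ (m % p + m / p * p)) x           ≡⟨ ^^-+ f (m % p) _ x ⟩
    (f ^^ (m % p)) ((f ^^ (m / p * p)) x)  ≡⟨ cong (f ^^ (m % p)) (period-* eq (m / p)) ⟩
    (f ^^ (m % p)) x                       ∎
    where open ≡-Reasoning

  -- On points of period `p`, `f ^^ (p ∸ 1)` serves as the inverse of `f`.
  period-pred : ∀ {p} .{{_ : NonZero p}} → (f ^^ p) x ≡ x → (f ^^ (p ∸ 1)) (f x) ≡ x
  period-pred {suc p} eq = trans (^^-suc f p x) eq

  -- By Bézout a multiple of one period exceeds a multiple of the other by 1, and both multiples are
  -- periods.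
  coprime-periods : ∀ {a b} → Coprime a b → (f ^^ a) x ≡ x → (f ^^ b) x ≡ x → f x ≡ x
  coprime-periods c eqa eqb with coprime-Bézout c
  ... | Bézout.+- u v eq = combine eqb eqa v u eq
    where
    combine : ∀ {a b} → (f ^^ a) x ≡ x → (f ^^ b) x ≡ x → ∀ v u → 1 + v * a ≡ u * b → f x ≡ x
    combine eqa eqb v u eq = trans (sym (cong f (period-* eqa v)))
      (trans (cong (λ k → (f ^^ k) x) eq) (period-* eqb u))
  ... | Bézout.-+ u v eq = trans (sym (cong f (period-* eqa u)))
      (trans (cong (λ k → (f ^^ k) x) eq) (period-* eqb v))

  -- Applying `f ^^ (p ∸ a)` to both sides completes the `a` steps to the full period `p`, which
  -- stands in for cancelling them.
  difference-period : ∀ {p a b} → (f ^^ p) x ≡ x → a < b → b ≤ p →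
    (f ^^ a) x ≡ (f ^^ b) x → (f ^^ (b ∸ a)) x ≡ x
  difference-period {p} {a} {b} eq a<b b≤p same = begin
    (f ^^ (b ∸ a)) x                ≡⟨ cong (f ^^ (b ∸ a)) eq ⟨
    (f ^^ (b ∸ a)) ((f ^^ p) x)     ≡⟨ ^^-+ f (b ∸ a) p x ⟨
    (f ^^ (b ∸ a + p)) x            ≡⟨ cong (λ k → (f ^^ k) x) exponents ⟩
    (f ^^ (p ∸ a + b)) x            ≡⟨ ^^-+ f (p ∸ a) b x ⟩
    (f ^^ (p ∸ a)) ((f ^^ b) x)     ≡⟨ cong (f ^^ (p ∸ a)) same ⟨
    (f ^^ (p ∸ a)) ((f ^^ a) x)     ≡⟨ ^^-+ f (p ∸ a) a x ⟨
    (f ^^ (p ∸ a + a)) x            ≡⟨ cong (λ k → (f ^^ k) x) (m∸n+n≡m a≤p) ⟩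
    (f ^^ p) x                      ≡⟨ eq ⟩
    x                               ∎
    where
    open ≡-Reasoning
    a≤p = ≤-trans (<⇒≤ a<b) b≤p
    exponents : b ∸ a + p ≡ p ∸ a + b
    exponents = begin
      b ∸ a + p   ≡⟨ +-comm (b ∸ a) p ⟩
      p + (b ∸ a) ≡⟨ +-∸-assoc p (<⇒≤ a<b) ⟨
      (p + b) ∸ a ≡⟨ cong (_∸ a) (+-comm p b) ⟩
      (b + p) ∸ a ≡⟨ +-∸-assoc b a≤p ⟩
      b + (p ∸ a) ≡⟨ +-comm b (p ∸ a) ⟩
      p ∸ a + b   ∎

  -- A positive `k` below the prime `p` is coprime to it. Hence a point of period `p` that is not
  -- fixed has `p` distinct iterates.
  prime-period : ∀ {p k} → Prime p → (f ^^ p) x ≡ x → 0 < k → k < p → (f ^^ k) x ≡ x → f x ≡ x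
  prime-period {p} {suc k} pr eqp 0<k k<p eqk = coprime-periods (prime⇒coprime pr k<p) eqp eqk

-- Fixed points of maps of prime period.

length-filter-split : ∀ {A : Set} {P : A → Set} (P? : Decidable P) xs →
  length xs ≡ length (filter P? xs) + length (filter (¬? ∘ P?) xs)
length-filter-split P? [] = refl
length-filter-split P? (x ∷ xs) with P? x
... | yes _ = cong suc (length-filter-split P? xs)
... | no _ = trans (cong suc (length-filter-split P? xs)) (sym (+-suc _ _))

module _ {A : Set} (_≟ᴬ_ : DecidableEquality A) {p : ℕ} (prime : Prime p) {σ : A → A} where

  private instance p≢0 = prime⇒nonZero prime

  open DecMembership _≟ᴬ_ using (_∈?_)

  FixedBy? : Decidable (λ x → σ x ≡ x)
  FixedBy? x = σ x ≟ᴬ x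

  -- Split off one orbit, which has exactly p elements.
  free-action : ∀ n (L : List A) → length L ≤ n → Unique L →
    (∀ {x} → x ∈ L → σ x ∈ L) → (∀ {x} → x ∈ L → (σ ^^ p) x ≡ x) →
    (∀ {x} → x ∈ L → σ x ≢ x) → p ∣ length L
  free-action n [] _ _ _ _ _ = p ∣0
  free-action (suc n) L@(x₀ ∷ _) (s≤s l≤n) unique closed period free =
    subst (p ∣_) (sym length-L)
      (∣m∣n⇒∣m+n (∣-reflexive (sym (length-applyUpTo _ p)))
        (free-action n rest rest≤n (Unique.filter⁺ outside? unique) rest-closed
          (period ∘ rest⊆L) (free ∘ rest⊆L)))
    where
    x₀∈L : x₀ ∈ L
    x₀∈L = here refl

    orbit : List A
    orbit = applyUpTo (λ k → (σ ^^ k) x₀) p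

    outside? : Decidable (_∉ orbit)
    outside? y = ¬? (y ∈? orbit)

    rest : List A
    rest = filter outside? L

    rest⊆L : rest ⊆ L
    rest⊆L = proj₁ ∘ ∈-filter⁻ outside? {xs = L}

    -- A repetition would give `x₀` a positive period below `p`, hence make it a fixed point.
    orbit-unique : Unique orbit
    orbit-unique = Unique.applyUpTo⁺₁ _ p λ {i} {j} i<j j<p eq → free x₀∈L
      (prime-period prime (period x₀∈L) (m<n⇒0<n∸m i<j) (≤-<-trans (m∸n≤m j i) j<p)
        (difference-period (period x₀∈L) i<j (<⇒≤ j<p) eq))

    power∈orbit : ∀ k → (σ ^^ k) x₀ ∈ orbit
    power∈orbit k = subst (_∈ orbit) (sym (period-% (period x₀∈L) k))
      (∈-applyUpTo⁺ (λ k → (σ ^^ k) x₀) (m%n<n k p))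

    power∈L : ∀ k → (σ ^^ k) x₀ ∈ L
    power∈L zero = x₀∈L
    power∈L (suc k) = closed (power∈L k)

    orbit⊆L : orbit ⊆ L
    orbit⊆L y∈ with ∈-applyUpTo⁻ (λ k → (σ ^^ k) x₀) y∈
    ... | k , _ , refl = power∈L k

    rest-closed : ∀ {y} → y ∈ rest → σ y ∈ rest
    rest-closed {y} y∈ with ∈-filter⁻ outside? {xs = L} y∈
    ... | y∈L , y∉ = ∈-filter⁺ outside? (closed y∈L) λ σy∈ → back (∈-applyUpTo⁻ (λ k → (σ ^^ k) x₀) σy∈)
      where
      back : (∃ λ k → k < p × σ y ≡ (σ ^^ k) x₀) → ⊥
      -- Undoing `σ` by `σ ^^ (p ∸ 1)` would put `y` itself into the orbit.
      back (k , _ , eq) = y∉ (subst (_∈ orbit) (sym y-power) (power∈orbit (p ∸ 1 + k)))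
        where
        y-power : y ≡ (σ ^^ (p ∸ 1 + k)) x₀
        y-power = trans (sym (period-pred {f = σ} {p = p} (period y∈L)))
          (trans (cong (σ ^^ (p ∸ 1)) eq) (sym (^^-+ σ (p ∸ 1) k x₀)))

    cover : L ⊆ orbit List.++ rest
    cover {y} y∈ with y ∈? orbit
    ... | yes y∈O = ∈-++⁺ˡ y∈O
    ... | no y∉O = ∈-++⁺ʳ orbit (∈-filter⁺ outside? y∈ y∉O)

    joined⊆L : orbit List.++ rest ⊆ L
    joined⊆L y∈ with ∈-++⁻ orbit y∈
    ... | inj₁ y∈O = orbit⊆L y∈O
    ... | inj₂ y∈R = rest⊆L y∈R

    length-L : length L ≡ length orbit + length rest
    length-L = trans
      (≤-antisym (unique-⊆⇒length≤ unique cover)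
        (unique-⊆⇒length≤ (Unique.++⁺ orbit-unique (Unique.filter⁺ outside? unique)
          λ { (y∈O , y∈R) → proj₂ (∈-filter⁻ outside? {xs = L} y∈R) y∈O }) joined⊆L))
      (length-++ orbit)

    -- The orbit is nonempty because `p` is positive, so the bound that the recursion runs on
    -- decreases.
    rest≤n : length rest ≤ n
    rest≤n = ≤-pred (≤-trans (+-monoˡ-≤ (length rest)
        (subst (1 ≤_) (sym (length-applyUpTo _ p)) (>-nonZero⁻¹ p)))
      (≤-trans (≤-reflexive (sym length-L)) (s≤s l≤n)))

  -- The moved elements form a list on which `σ` acts freely, so their number is a multiple of `p`,
  -- and removing them does not affect divisibility by `p`.
  fixed-count : ∀ {L} → Unique L → (∀ {x} → x ∈ L → σ x ∈ L) → (∀ {x} → x ∈ L → (σ ^^ p) x ≡ x) →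
    ¬ p ∣ length L → ¬ p ∣ length (filter FixedBy? L)
  fixed-count {L} unique closed period p∤L p∣fixed = p∤L
    (subst (p ∣_) (sym (length-filter-split FixedBy? L)) (∣m∣n⇒∣m+n p∣fixed
      (free-action _ moved ≤-refl (Unique.filter⁺ Moved? unique) moved-closed
        (λ x∈ → period (proj₁ (∈-filter⁻ Moved? {xs = L} x∈)))
        (λ x∈ → proj₂ (∈-filter⁻ Moved? {xs = L} x∈)))))
    where
    Moved? = ¬? ∘ FixedBy?
    moved = filter Moved? L
    -- If `σ x` were fixed, its iterate under `σ ^^ (p ∸ 1)` would be both `σ x` and `x`.
    moved-closed : ∀ {x} → x ∈ moved → σ x ∈ moved
    moved-closed {x} x∈ with ∈-filter⁻ Moved? {xs = L} x∈
    ... | x∈L , moves = ∈-filter⁺ Moved? (closed x∈L) λ fixed → moves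
      (trans (sym (fixed-^^ σ fixed (p ∸ 1))) (period-pred {f = σ} {p = p} (period x∈L)))

indivisible-length⇒∃ : ∀ {A : Set} {p} {L : List A} → ¬ p ∣ length L → ∃ (_∈ L)
indivisible-length⇒∃ {p = p} {[]} p∤ = contradiction (p ∣0) p∤
indivisible-length⇒∃ {L = x ∷ _} _ = x , here refl

module _ {n p : ℕ} (prime : Prime p) (p∤n : ¬ p ∣ n) {σ : Fin n → Fin n}
         (period : ∀ i → (σ ^^ p) i ≡ i) where

  fixed-by-σ : List (Fin n)
  fixed-by-σ = filter (FixedBy? Fin._≟_ prime {σ}) (allFin n)

  fixed-by-σ-count : ¬ p ∣ length fixed-by-σ
  fixed-by-σ-count = fixed-count Fin._≟_ prime (Unique.allFin⁺ n) (λ _ → ∈-allFin _) (λ _ → period _)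
    (subst (λ l → ¬ p ∣ l) (sym (length-tabulate {n = n} id)) p∤n)

  σ-fixes : ∀ {i} → i ∈ fixed-by-σ → σ i ≡ i
  σ-fixes i∈ = proj₂ (∈-filter⁻ (FixedBy? Fin._≟_ prime) {xs = allFin n} i∈)

  fixed-point : ∃ λ i → σ i ≡ i
  fixed-point with indivisible-length⇒∃ fixed-by-σ-count
  ... | i , i∈ = i , σ-fixes i∈

  -- As `τ` commutes with `σ`, it preserves the list of fixed points of `σ`, to whose length the
  -- count applies again. The period of `τ` is asked for at these points only, which admits the case
  -- `σ = τ ^^ p`.
  common-fixed-point : ∀ {τ : Fin n → Fin n} → (∀ i → σ (τ i) ≡ τ (σ i)) →
    (∀ i → σ i ≡ i → (τ ^^ p) i ≡ i) → ∃ λ i → σ i ≡ i × τ i ≡ i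
  common-fixed-point {τ} commute τ-period with indivisible-length⇒∃ (fixed-count Fin._≟_ prime {τ}
      (Unique.filter⁺ (FixedBy? Fin._≟_ prime) (Unique.allFin⁺ n))
      (λ {i} i∈ → ∈-filter⁺ (FixedBy? Fin._≟_ prime) (∈-allFin _) (trans (commute i) (cong τ (σ-fixes i∈))))
      (τ-period _ ∘ σ-fixes) fixed-by-σ-count)
  ... | i , i∈ with ∈-filter⁻ (FixedBy? Fin._≟_ prime) {xs = fixed-by-σ} i∈
  ... | i∈σ , τi≡i = i , σ-fixes i∈σ , τi≡i

-- Coordinate permutations, translations and the group of their composites.

_≈?_ : ∀ {n} (f g : Map n) → Dec (f ≈ g)
f ≈? g = ∀word? _ λ x → even? x →-dec (f x ≟ʷ g x)

-- `permute π` is the case `ρ = π ⟨$⟩ˡ_`. Bare maps of coordinates can be iterated without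
-- constructing permutations.
rearrange : ∀ {n} → (Fin n → Fin n) → Word n → Word n
rearrange ρ x = tabulate (Vec.lookup x ∘ ρ)

rearrange-⊕ : ∀ {n} (ρ : Fin n → Fin n) (x y : Word n) →
  rearrange ρ (x ⊕ y) ≡ rearrange ρ x ⊕ rearrange ρ y
rearrange-⊕ ρ x y = trans (tabulate-cong λ i → lookup-zipWith _xor_ (ρ i) x y)
                          (sym (zipWith-tabulate (Vec.lookup x ∘ ρ) (Vec.lookup y ∘ ρ)))
  where
  zipWith-tabulate : ∀ {n} (f g : Fin n → Bool) →
    tabulate f ⊕ tabulate g ≡ tabulate (λ i → f i xor g i)
  zipWith-tabulate {zero} f g = refl
  zipWith-tabulate {suc n} f g = cong ((f Fin.zero xor g Fin.zero) ∷_) (zipWith-tabulate (f ∘ Fin.suc) (g ∘ Fin.suc))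

rearrange-∘ : ∀ {n} (ρ ρ′ : Fin n → Fin n) (x : Word n) →
  rearrange ρ (rearrange ρ′ x) ≡ rearrange (ρ′ ∘ ρ) x
rearrange-∘ ρ ρ′ x = tabulate-cong λ i → lookup∘tabulate (Vec.lookup x ∘ ρ′) (ρ i)

rearrange-id : ∀ {n} {ρ : Fin n → Fin n} → (∀ i → ρ i ≡ i) → ∀ x → rearrange ρ x ≡ x
rearrange-id eq x = trans (tabulate-cong (cong (Vec.lookup x) ∘ eq)) (tabulate∘lookup x)

-- Written as a sum over the coordinates, the weight is invariant under reindexing.
weight-permute : ∀ {n} (π : Permutation′ n) (x : Word n) → weight (permute π x) ≡ weight x
weight-permute {n} π x = begin
  weight (permute π x)                                  ≡⟨ weight-sum (permute π x) ⟩
  Sum.sum (λ i → bit (Vec.lookup (permute π x) i))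
    ≡⟨ Sum.sum-cong-≗ {n = n} (λ i → cong bit (lookup∘tabulate (λ j → Vec.lookup x (π ⟨$⟩ˡ j)) i)) ⟩
  Sum.sum (λ i → bit (Vec.lookup x (π ⟨$⟩ˡ i)))         ≡⟨ Sum.sum-permute (bit ∘ Vec.lookup x) (Perm.flip π) ⟨
  Sum.sum (bit ∘ Vec.lookup x)                          ≡⟨ weight-sum x ⟨
  weight x                                              ∎
  where
  open ≡-Reasoning
  weight-sum : ∀ {n} (x : Word n) → weight x ≡ Sum.sum (bit ∘ Vec.lookup x)
  weight-sum [] = refl
  weight-sum (b ∷ x) = trans (weight-∷ b x) (cong (bit b +_) (weight-sum x))

even-permute : ∀ {n} (π : Permutation′ n) {x : Word n} → Even x → Even (permute π x)
even-permute π {x} = subst (2 ∣_) (sym (weight-permute π x))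

even-0ʷ : ∀ n → Even (0ʷ {n})
even-0ʷ zero = 2 ∣0
even-0ʷ (suc n) = even-0ʷ n

module _ {n : ℕ} where

  Affine : (Fin n → Fin n) → Word n → Map n → Set
  Affine ρ c f = f ≈ λ x → rearrange ρ x ⊕ c

  -- `f` is described on even words only, so the values of `g` on even words have to be even.
  affine-∘ : ∀ {ρ ρ′ c c′} {f g : Map n} → (∀ x → Even x → Even (g x)) →
    Affine ρ c f → Affine ρ′ c′ g → Affine (ρ′ ∘ ρ) (rearrange ρ c′ ⊕ c) (f ∘ g)
  affine-∘ {ρ} {ρ′} {c} {c′} {f} {g} even-g f-affine g-affine x ex = begin
    f (g x)                                              ≡⟨ f-affine (g x) (even-g x ex) ⟩
    rearrange ρ (g x) ⊕ c                                ≡⟨ cong (λ y → rearrange ρ y ⊕ c) (g-affine x ex) ⟩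
    rearrange ρ (rearrange ρ′ x ⊕ c′) ⊕ c                ≡⟨ cong (_⊕ c) (rearrange-⊕ ρ (rearrange ρ′ x) c′) ⟩
    rearrange ρ (rearrange ρ′ x) ⊕ rearrange ρ c′ ⊕ c    ≡⟨ cong (λ y → y ⊕ rearrange ρ c′ ⊕ c) (rearrange-∘ ρ ρ′ x) ⟩
    rearrange (ρ′ ∘ ρ) x ⊕ rearrange ρ c′ ⊕ c            ≡⟨ ⊕-assoc _ _ c ⟩
    rearrange (ρ′ ∘ ρ) x ⊕ (rearrange ρ c′ ⊕ c)          ∎
    where open ≡-Reasoning

  IsG-even : {f : Map n} → IsG f → ∀ x → Even x → Even (f x)
  IsG-even (π , c , ec , f≈) x ex =
    subst Even (sym (f≈ x ex)) (even-⊕ {x = permute π x} {c} (even-permute π {x} ex) ec)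

  IsG-id : IsG {n} id
  IsG-id = Perm.id , 0ʷ , even-0ʷ n ,
    λ x _ → sym (trans (⊕-identityʳ _) (tabulate∘lookup x))

  IsG-∘ : {f g : Map n} → IsG f → IsG g → IsG (f ∘ g)
  IsG-∘ {f} {g} F@(π , c , ec , f≈) G@(π′ , c′ , ec′ , g≈) =
    π′ ∘ₚ π , permute π c′ ⊕ c , even-⊕ {x = permute π c′} {c} (even-permute π {c′} ec′) ec ,
    affine-∘ {π ⟨$⟩ˡ_} {π′ ⟨$⟩ˡ_} {c} {c′} {f} {g} (IsG-even {g} G) f≈ g≈

  IsG-^^ : {f : Map n} → IsG f → ∀ k → IsG (f ^^ k)
  IsG-^^ F zero = IsG-id
  IsG-^^ {f} F (suc k) = IsG-∘ {f} {f ^^ k} F (IsG-^^ {f} F k)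

  affine-^^ : ∀ {ρ c} {f : Map n} → IsG f → Affine ρ c f → ∀ k → ∃ λ c′ → Affine (ρ ^^ k) c′ (f ^^ k)
  affine-^^ F aff zero = 0ʷ , λ x _ → sym (trans (⊕-identityʳ _) (tabulate∘lookup x))
  affine-^^ {ρ} {c} {f} F aff (suc k) with affine-^^ {ρ} {c} {f} F aff k
  ... | c′ , affk = rearrange ρ c′ ⊕ c , λ x ex →
    trans (affine-∘ {ρ} {ρ ^^ k} {c} {c′} {f} {f ^^ k} (IsG-even {f ^^ k} (IsG-^^ {f} F k)) aff affk x ex)
          -- Composition reverses the coordinate maps; `^^-suc` turns `(ρ ^^ k) ∘ ρ` into
          -- `ρ ^^ suc k`.
          (cong (_⊕ (rearrange ρ c′ ⊕ c)) (tabulate-cong (cong (Vec.lookup x) ∘ ^^-suc ρ k)))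

  -- Two of the `n + 1` iterates with exponents 0 to `n` agree at `i`, and injectivity cancels the
  -- smaller exponent. Writing the period as `suc (toℕ d)` keeps it between 1 and `n`.
  injective-period : ∀ {ρ : Fin n → Fin n} → (∀ {i j} → ρ i ≡ ρ j → i ≡ j) →
    ∀ i → ∃ λ (d : Fin n) → (ρ ^^ suc (toℕ d)) i ≡ i
  injective-period {ρ} inj i with pigeonhole (n<1+n n) (λ k → (ρ ^^ toℕ k) i)
  ... | a , b , a<b , eq = fromℕ< d<n ,
      trans (cong (λ d → (ρ ^^ suc d) i) (toℕ-fromℕ< d<n))
            (trans (cong (λ d → (ρ ^^ d) i) (suc-pred-gap)) (sym (cancel (toℕ a) (trans eq split))))
    where
    gap = toℕ b ∸ toℕ a
    0<gap : 0 < gap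
    0<gap = m<n⇒0<n∸m a<b
    suc-pred-gap : suc (gap ∸ 1) ≡ gap
    suc-pred-gap = m+[n∸m]≡n 0<gap
    d<n : gap ∸ 1 < n
    d<n = subst (_≤ n) (sym suc-pred-gap) (≤-trans (m∸n≤m (toℕ b) (toℕ a)) (≤-pred (toℕ<n b)))
    split : (ρ ^^ toℕ b) i ≡ (ρ ^^ toℕ a) ((ρ ^^ gap) i)
    split = trans (cong (λ k → (ρ ^^ k) i) (sym (m+[n∸m]≡n (<⇒≤ a<b)))) (^^-+ ρ (toℕ a) gap i)
    cancel : ∀ {i j} k → (ρ ^^ k) i ≡ (ρ ^^ k) j → i ≡ j
    cancel zero eq = eq
    cancel (suc k) eq = cancel k (inj eq)

  -- A power of f that undoes the coordinate permutation is a translation, hence an involution.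
  IsG-exponent : ∀ {f : Map n} {N} → (∀ (d : Fin n) → suc (toℕ d) ∣ N) → IsG f → f ^^ (2 * N) ≈ id
  IsG-exponent {f} {N} all∣N F@(π , c , _ , f≈) x ex = begin
    (f ^^ (2 * N)) x            ≡⟨ ^^-* f 2 N x ⟨
    (f ^^ N) ((f ^^ N) x)       ≡⟨ translation _ (IsG-even {f ^^ N} (IsG-^^ {f} F N) x ex) ⟩
    (f ^^ N) x ⊕ t              ≡⟨ cong (_⊕ t) (translation x ex) ⟩
    x ⊕ t ⊕ t                   ≡⟨ ⊕-assoc x t t ⟩
    x ⊕ (t ⊕ t)                 ≡⟨ cong (x ⊕_) (⊕-self t) ⟩
    x ⊕ 0ʷ                      ≡⟨ ⊕-identityʳ x ⟩
    x                           ∎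
    where
    open ≡-Reasoning
    ρ = π ⟨$⟩ˡ_
    ρ-injective : ∀ {i j} → ρ i ≡ ρ j → i ≡ j
    ρ-injective eq = trans (sym (inverseʳ π)) (trans (cong (π ⟨$⟩ʳ_) eq) (inverseʳ π))
    ρ^N : ∀ i → (ρ ^^ N) i ≡ i
    ρ^N i with injective-period ρ-injective i
    ... | d , eq = period-∣ eq (all∣N d)
    t = proj₁ (affine-^^ {ρ} {c} {f} F f≈ N)
    translation : ∀ y → Even y → (f ^^ N) y ≡ y ⊕ t
    translation y ey = trans (proj₂ (affine-^^ {ρ} {c} {f} F f≈ N) y ey)
                             (cong (_⊕ t) (rearrange-id ρ^N y))

  -- The primes are removed one at a time: the first `p` whose removal leaves an exponent with a
  -- nontrivial power is the order of that power.
  prime-order-power : ∀ {f : Map n} ps → All Prime ps → f ^^ product ps ≈ id → ¬ f ≈ id →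
    ∃₂ λ p m → p ∈ ps × ¬ (f ^^ m ≈ id) × ((f ^^ m) ^^ p ≈ id)
  prime-order-power [] _ f≈id f≉id = contradiction f≈id f≉id
  prime-order-power {f} (p ∷ ps) (_ ∷ primes) f^≈id f≉id with (f ^^ product ps) ≈? id
  ... | no ≉id = p , product ps , here refl , ≉id ,
        λ x ex → trans (^^-* f p (product ps) x) (f^≈id x ex)
  ... | yes ≈id with prime-order-power ps primes ≈id f≉id
  ... | q , m , q∈ , rest = q , m , there q∈ , rest

  -- Cyclic subgroups and Klein four-groups.

  cyclic : Map n → ℕ → List (Map n)
  cyclic f m = applyUpTo (f ^^_) m

  cyclic-subgroup : ∀ {S : Map n → Set} {f m} .{{_ : NonZero m}} → (∀ k → S (f ^^ k)) → f ^^ m ≈ id →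
    (∀ k → 0 < k → k < m → ¬ f ^^ k ≈ id) → IsSubgroupOf S (cyclic f m)
  cyclic-subgroup {S} {f} {m} powers f^m≈id minimal =
    All.applyUpTo⁺₂ (f ^^_) m powers ,
    AllPairs.applyUpTo⁺₁ (f ^^_) m (λ {i} {j} i<j j<m same →
      minimal (j ∸ i) (m<n⇒0<n∸m i<j) (≤-<-trans (m∸n≤m j i) j<m)
        (λ x ex → difference-period (f^m≈id x ex) i<j (<⇒≤ j<m) (same x ex))) ,
    Any.applyUpTo⁺ (f ^^_) (λ _ _ → refl) (>-nonZero⁻¹ m) ,
    All.applyUpTo⁺₂ (f ^^_) m (λ a → All.applyUpTo⁺₂ (f ^^_) m (λ b →
      Any.applyUpTo⁺ (f ^^_) (λ x ex → trans (sym (^^-+ f a b x)) (period-% (f^m≈id x ex) (a + b)))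
        (m%n<n (a + b) m))) ,
    All.applyUpTo⁺₁ (f ^^_) m (λ {a} a<m → Any.applyUpTo⁺ (f ^^_) (inverse a (<⇒≤ a<m)) (m%n<n (m ∸ a) m))
    where
    -- The remainder matters for `a = 0`, where the exponent `m ∸ a` is `m` and lies outside the
    -- list.
    inverse : ∀ a → a ≤ m → ((f ^^ a) ∘ (f ^^ ((m ∸ a) % m))) ≈ id
    inverse a a≤m x ex = begin
      (f ^^ a) ((f ^^ ((m ∸ a) % m)) x)  ≡⟨ cong (f ^^ a) (period-% (f^m≈id x ex) (m ∸ a)) ⟨
      (f ^^ a) ((f ^^ (m ∸ a)) x)        ≡⟨ ^^-+ f a (m ∸ a) x ⟨
      (f ^^ (a + (m ∸ a))) x             ≡⟨ cong (λ k → (f ^^ k) x) (m+[n∸m]≡n a≤m) ⟩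
      (f ^^ m) x                         ≡⟨ f^m≈id x ex ⟩
      x                                  ∎
      where open ≡-Reasoning

  prime-cyclic-subgroup : ∀ {S : Map n → Set} {f p} → Prime p → (∀ k → S (f ^^ k)) → f ^^ p ≈ id →
    ¬ f ≈ id → IsSubgroupOf S (cyclic f p)
  prime-cyclic-subgroup {f = f} p-prime powers f^p≈id f≉id =
    cyclic-subgroup {{prime⇒nonZero p-prime}} powers f^p≈id
      λ k 0<k k<p f^k≈id → f≉id λ x ex → prime-period p-prime (f^p≈id x ex) 0<k k<p (f^k≈id x ex)

  cyclic4-subgroup : ∀ {S : Map n → Set} {f} → (∀ k → S (f ^^ k)) → f ^^ 4 ≈ id →
    ¬ f ^^ 2 ≈ id → IsSubgroupOf S (cyclic f 4)
  cyclic4-subgroup {f = f} powers f⁴≈id f²≉id = cyclic-subgroup powers f⁴≈id minimal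
    where
    minimal : ∀ k → 0 < k → k < 4 → ¬ f ^^ k ≈ id
    minimal 1 _ _ f≈id = f²≉id λ x ex → fixed-^^ f (f≈id x ex) 2
    minimal 2 _ _ f²≈id = f²≉id f²≈id
    minimal 3 _ _ f³≈id = f²≉id λ x ex →
      fixed-^^ f (trans (sym (cong f (f³≈id x ex))) (f⁴≈id x ex)) 2
    minimal (suc (suc (suc (suc _)))) _ (s≤s (s≤s (s≤s (s≤s ()))))

  module Klein {g h : Map n} (even-g : ∀ x → Even x → Even (g x)) (even-h : ∀ x → Even x → Even (h x))
    (g² : (g ∘ g) ≈ id) (h² : (h ∘ h) ≈ id) (gh² : ((g ∘ h) ∘ (g ∘ h)) ≈ id) where

    -- Put the square of `g ∘ h` in front of `h ∘ g`, then cancel `h ∘ h` and `g ∘ g`.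
    commute : (h ∘ g) ≈ (g ∘ h)
    commute x ex = begin
      h (g x)                    ≡⟨ gh² _ (even-h _ (even-g x ex)) ⟨
      g (h (g (h (h (g x)))))    ≡⟨ cong (g ∘ h ∘ g) (h² _ (even-g x ex)) ⟩
      g (h (g (g x)))            ≡⟨ cong (g ∘ h) (g² x ex) ⟩
      g (h x)                    ∎
      where open ≡-Reasoning

    klein : List (Map n)
    klein = id ∷ g ∷ h ∷ g ∘ h ∷ []

    klein-subgroup : ∀ {S : Map n → Set} → S id → S g → S h → S (g ∘ h) →
      ¬ g ≈ id → ¬ h ≈ id → ¬ g ≈ h → IsSubgroupOf S klein
    klein-subgroup Sid Sg Sh Sgh g≉id h≉id g≉h =
      (Sid ∷ Sg ∷ Sh ∷ Sgh ∷ []) ,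
      ( ((λ e → g≉id λ x ex → sym (e x ex)) ∷ (λ e → h≉id λ x ex → sym (e x ex)) ∷ gh≉id ∷ [])
      ∷ (g≉h ∷ g≉gh ∷ [])
      ∷ (h≉gh ∷ [])
      ∷ [] ∷ []) ,
      here (λ _ _ → refl) ,
      -- The multiplication table, one line per left factor. In the list of inverses after it, each
      -- element is its own inverse.
      ( (at0 (λ _ _ → refl) ∷ at1 (λ _ _ → refl) ∷ at2 (λ _ _ → refl) ∷ at3 (λ _ _ → refl) ∷ [])
      ∷ (at1 (λ _ _ → refl) ∷ at0 g² ∷ at3 (λ _ _ → refl) ∷ at2 (λ x ex → g² _ (even-h x ex)) ∷ [])
      ∷ (at2 (λ _ _ → refl) ∷ at3 commute ∷ at0 h² ∷ at1 hgh ∷ [])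
      ∷ (at3 (λ _ _ → refl) ∷ at2 ghg ∷ at1 (λ x ex → cong g (h² x ex)) ∷ at0 gh² ∷ [])
      ∷ []) ,
      (at0 (λ _ _ → refl) ∷ at1 g² ∷ at2 h² ∷ at3 gh² ∷ [])
      where
      module _ {P : Map n → Set} where
        at0 : P id → Any P klein
        at0 p = here p
        at1 : P g → Any P klein
        at1 p = there (here p)
        at2 : P h → Any P klein
        at2 p = there (there (here p))
        at3 : P (g ∘ h) → Any P klein
        at3 p = there (there (there (here p)))

      hgh : (h ∘ (g ∘ h)) ≈ g
      hgh x ex = trans (commute (h x) (even-h x ex)) (cong g (h² x ex))

      ghg : ((g ∘ h) ∘ g) ≈ h
      ghg x ex = trans (cong g (commute x ex)) (g² (h x) (even-h x ex))

      gh≉id : ¬ id ≈ (g ∘ h)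
      gh≉id e = g≉h λ x ex → trans (cong g (e x ex)) (g² _ (even-h x ex))

      g≉gh : ¬ g ≈ (g ∘ h)
      g≉gh e = h≉id λ x ex → trans (sym (g² _ (even-h x ex))) (trans (cong g (sym (e x ex))) (g² x ex))

      h≉gh : ¬ h ≈ (g ∘ h)
      h≉gh e = g≉id λ x ex → trans (cong g (sym (h² x ex)))
        (trans (sym (e (h x) (even-h x ex))) (h² x ex))

-- The words of the doubly extended Hamming code, and counting tools.

hamming7? : ∀ y → Dec (Hamming7 y)
hamming7? y = Fin.all? λ r → dot (Vec.lookup Hmat r) y Bool.≟ false

doublyExtend : Word 7 → Word 9
doublyExtend y = y Vec.++ (parity y ∷ false ∷ [])

hammingWords : List (Word 9)
hammingWords = map doublyExtend (filter hamming7? (words 7))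

hammingWords-complete : ∀ {x} → DoublyExtHamming x → x ∈ hammingWords
hammingWords-complete (y , hy , refl) =
  ∈-map⁺ doublyExtend (∈-filter⁺ hamming7? (words-complete y) hy)

length-concatMap : ∀ {A B : Set} (f : A → List B) xs → length (concatMap f xs) ≡ ∑ xs (length ∘ f)
length-concatMap f [] = refl
length-concatMap f (x ∷ xs) = trans (length-++ (f x)) (cong (length (f x) +_) (length-concatMap f xs))

∑-mono : ∀ {A : Set} (L : List A) {f g : A → ℕ} → (∀ x → f x ≤ g x) → ∑ L f ≤ ∑ L g
∑-mono [] f≤g = z≤n
∑-mono (x ∷ L) f≤g = +-mono-≤ (f≤g x) (∑-mono L f≤g)

-- Automorphisms of a family of codes.

module _ {n k : ℕ} {𝒞 : Fin k → Code n} where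

  InAutFam-id : InAutFam 𝒞 id
  InAutFam-id = IsG-id ,
    (λ i → i , (λ { x (_ , c , refl) → c }) , (λ x c → x , c , refl)) ,
    (λ i → i , (λ x c → x , c , refl) , (λ { x (_ , c , refl) → c }))

  InAutFam-∘ : ∀ {f g} → InAutFam 𝒞 f → InAutFam 𝒞 g → InAutFam 𝒞 (f ∘ g)
  InAutFam-∘ {f} {g} (F , f-to , f-from) (G , g-to , g-from) = IsG-∘ {f = f} {g} F G , to , from
    where
    to : ∀ i → ∃ λ j → image (f ∘ g) (𝒞 i) ≐ 𝒞 j
    to i with g-to i
    ... | j , g⊆ , g⊇ with f-to j
    ... | l , f⊆ , f⊇ = l ,
      (λ { y (x , c , refl) → f⊆ _ (g x , g⊆ _ (x , c , refl) , refl) }) ,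
      (λ y c → pull (f⊇ y c))
      where
      pull : ∀ {y} → image f (𝒞 j) y → image (f ∘ g) (𝒞 i) y
      pull (z , cz , refl) with g⊇ z cz
      ... | x , cx , refl = x , cx , refl
    from : ∀ j → ∃ λ i → 𝒞 j ≐ image (f ∘ g) (𝒞 i)
    from l with f-from l
    ... | j , f⊇ , f⊆ with g-from j
    ... | i , g⊇ , g⊆ = i ,
      (λ y c → pull (f⊇ y c)) ,
      (λ { y (x , c , refl) → f⊆ _ (g x , g⊆ _ (x , c , refl) , refl) })
      where
      pull : ∀ {y} → image f (𝒞 j) y → image (f ∘ g) (𝒞 i) y
      pull (z , cz , refl) with g⊇ z cz
      ... | x , cx , refl = x , cx , refl

  InAutFam-^^ : ∀ {f} → InAutFam 𝒞 f → ∀ m → InAutFam 𝒞 (f ^^ m)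
  InAutFam-^^ F zero = InAutFam-id
  InAutFam-^^ {f} F (suc m) = InAutFam-∘ {f} {f ^^ m} F (InAutFam-^^ F m)

-- The action of automorphisms on the codes of a partition.

module _ {n k : ℕ} {𝒞 : Fin k → Code n} (partition : IsPartition 𝒞) where

  private
    isCode : ∀ i → IsCode (𝒞 i)
    isCode = proj₁ partition
    inhabited : ∀ i → ∃ (𝒞 i)
    inhabited = proj₁ (proj₂ partition)
    covers : ∀ x → Even x → ∃ λ i → 𝒞 i x
    covers = proj₂ (proj₂ (proj₂ partition))

  index-unique : ∀ {i j x} → 𝒞 i x → 𝒞 j x → i ≡ j
  index-unique {i} {j} {x} ci cj with i Fin.≟ j
  ... | yes eq = eq
  ... | no i≢j = ⊥-elim (proj₁ (proj₂ (proj₂ partition)) i j x i≢j ci cj)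

  -- The codes are arbitrary predicates, but the partition supplies the code that contains an even
  -- word, and its index can be compared with `i`.
  member? : ∀ i → Decidable (𝒞 i)
  member? i x with even? x
  ... | no odd = no (odd ∘ isCode i x)
  ... | yes ex with covers x ex
  ... | j , cj = map′ (λ { refl → cj }) (index-unique cj) (j Fin.≟ i)

  Moves : Map n → Fin k → Fin k → Set
  Moves f i j = ∀ x → 𝒞 i x → 𝒞 j (f x)

  -- A word of the nonempty `𝒞 i` has its image in both target codes. Identities between maps
  -- thereby become identities between their actions on indices.
  moves-unique : ∀ {f g i j l} → f ≈ g → Moves f i j → Moves g i l → j ≡ l
  moves-unique {i = i} {l = l} f≈g f-moves g-moves with inhabited i
  ... | x , c = index-unique (f-moves x c) (subst (𝒞 l) (sym (f≈g x (isCode i x c))) (g-moves x c))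

  action : ∀ {f} → InAutFam 𝒞 f → Fin k → Fin k
  action (_ , to , _) i = proj₁ (to i)

  action-moves : ∀ {f} (F : InAutFam 𝒞 f) i → Moves f i (action F i)
  action-moves (_ , to , _) i x c = proj₁ (proj₂ (to i)) _ (x , c , refl)

  action-^^-moves : ∀ {f} (F : InAutFam 𝒞 f) m i → Moves (f ^^ m) i ((action F ^^ m) i)
  action-^^-moves F zero i x c = c
  action-^^-moves F (suc m) i x c = action-moves F _ _ (action-^^-moves F m i x c)

  action-period : ∀ {f} (F : InAutFam 𝒞 f) m → f ^^ m ≈ id → ∀ i → (action F ^^ m) i ≡ i
  action-period {f} F m f^m≈id i = moves-unique f^m≈id (action-^^-moves F m i) (λ _ c → c)

  fixes⇒InAut : ∀ {f} → InAutFam 𝒞 f → ∀ {i} → Moves f i i → InAut (𝒞 i) f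
  fixes⇒InAut {f} F@(isG , to , _) {i} moves =
    isG , subst (λ j → image f (𝒞 i) ≐ 𝒞 j)
      (moves-unique (λ _ _ → refl) (action-moves F i) moves) (proj₂ (to i))

  cyclic-fixes : ∀ {f} (F : InAutFam 𝒞 f) m {i} → action F i ≡ i → All (InAut (𝒞 i)) (cyclic f m)
  cyclic-fixes {f} F m {i} fixed = All.applyUpTo⁺₂ (f ^^_) m λ a →
    fixes⇒InAut (InAutFam-^^ F a) (subst (Moves (f ^^ a) i) (fixed-^^ (action F) fixed a) (action-^^-moves F a i))

  codeWords : Fin k → List (Word n)
  codeWords i = filter (member? i) (words n)

  codeWords-unique : ∀ i → Unique (codeWords i)
  codeWords-unique i = Unique.filter⁺ (member? i) (words-unique n)

  codeWords⊆ : ∀ i {x} → x ∈ codeWords i → 𝒞 i x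
  codeWords⊆ i = proj₂ ∘ ∈-filter⁻ (member? i) {xs = words n}

  even-count : length (filter even? (words n)) ≤ ∑ (allFin k) (length ∘ codeWords)
  even-count = subst (length (filter even? (words n)) ≤_) (length-concatMap codeWords (allFin k))
    (unique-⊆⇒length≤ (Unique.filter⁺ even? (words-unique n)) located)
    where
    located : filter even? (words n) ⊆ concatMap codeWords (allFin k)
    located {x} x∈ with covers x (proj₂ (∈-filter⁻ even? {xs = words n} x∈))
    ... | i , c = ∈-concatMap⁺ codeWords
      (Any.map (λ { refl → ∈-filter⁺ (member? i) (words-complete x) c }) (∈-allFin i))

-- The code of 16 words in a partition into 13 codes.

module _ {𝒞 : Fin 13 → Code 9} (partition : IsPartition 𝒞) (minDist : ∀ i → MinDist≥ 4 (𝒞 i)) where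

  private
    size : Fin 13 → ℕ
    size i = length (codeWords partition i)

    bound : Fin 13 → Fin 13 → Fin 13 → ℕ
    bound i j l with l Fin.≟ i | l Fin.≟ j
    ... | no _ | no _ = 20
    ... | _ | _ = 16

  -- Otherwise the partition would have at most 16 + 16 + 11 · 20 = 252 < 256 words.
  small-code-unique : ∀ {i j} → size i ≤ 16 → size j ≤ 16 → i ≡ j
  small-code-unique {i} {j} i-small j-small with i Fin.≟ j
  ... | yes eq = eq
  ... | no i≢j = contradiction
      (≤-trans (even-count partition) (≤-trans (∑-mono (allFin 13) size≤bound) (total i j i≢j)))
      -- The number of even words of length 9 evaluates to 256.
      (from-no (256 ≤? 252))
    where
    size≤bound : ∀ l → size l ≤ bound i j l
    size≤bound l with l Fin.≟ i | l Fin.≟ j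
    ... | yes refl | _ = i-small
    ... | no _ | yes refl = j-small
    ... | no _ | no _ = code-size≤20 (proj₁ partition l) (minDist l)
                          (codeWords-unique partition l) (codeWords⊆ partition l)
    total : ∀ i j → i ≢ j → ∑ (allFin 13) (bound i j) ≤ 252
    total = from-yes (Fin.all? λ i → Fin.all? λ j →
      ¬? (i Fin.≟ j) →-dec (∑ (allFin 13) (bound i j) ≤? 252))

  covered-size : ∀ i {L} → (∀ {x} → 𝒞 i x → x ∈ L) → size i ≤ length L
  covered-size i cover = unique-⊆⇒length≤ (codeWords-unique partition i) (cover ∘ codeWords⊆ partition i)

  -- The image of `𝒞 i` under `g` is again a code of the partition with at most 16 words, and there
  -- is only one such code.
  hamming-fixed : ∀ {i} → Equivalent (𝒞 i) DoublyExtHamming → ∀ {g} (G : InAutFam 𝒞 g) →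
    action partition G i ≡ i
  hamming-fixed {i} (f , _ , _ , ⊆f) {g} G@(_ , to , _) =
    small-code-unique (subst (size (action partition G i) ≤_) length-g (covered-size (action partition G i) in-g))
                      (subst (size i ≤_) length-f (covered-size i in-f))
    where
    -- The length of `hammingWords` evaluates to 16.
    length-f : length (map f hammingWords) ≡ 16
    length-f = length-map f hammingWords
    length-g : length (map g (map f hammingWords)) ≡ 16
    length-g = trans (length-map g (map f hammingWords)) length-f
    in-f : ∀ {x} → 𝒞 i x → x ∈ map f hammingWords
    in-f {x} c with ⊆f x c
    ... | y , hy , refl = ∈-map⁺ f (hammingWords-complete hy)
    in-g : ∀ {x} → 𝒞 (action partition G i) x → x ∈ map g (map f hammingWords)
    in-g {x} c with proj₂ (proj₂ (to i)) x c
    ... | y , cy , refl = ∈-map⁺ g (in-f cy)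

-- Nontrivial elements and the exponent of the group for length 9.

atLeast2⇒nontrivial : ∀ {n} {S : Map n → Set} → AtLeast 2 S → ∃ λ f → S f × ¬ f ≈ id
atLeast2⇒nontrivial (f ∷ g ∷ [] , refl , Sf ∷ Sg ∷ [] , (f≉g ∷ []) ∷ _) with f ≈? id
... | no f≉id = f , Sf , f≉id
... | yes f≈id = g , Sg , λ g≈id → f≉g λ x ex → trans (f≈id x ex) (sym (g≈id x ex))

atLeast3⇒two-nontrivial : ∀ {n} {S : Map n → Set} → AtLeast 3 S →
  ∃₂ λ f g → S f × S g × ¬ f ≈ id × ¬ g ≈ id × ¬ f ≈ g
atLeast3⇒two-nontrivial
  (f ∷ g ∷ h ∷ [] , refl , Sf ∷ Sg ∷ Sh ∷ [] , (f≉g ∷ f≉h ∷ []) ∷ (g≉h ∷ []) ∷ _)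
  with f ≈? id | g ≈? id
... | yes f≈id | _ = g , h , Sg , Sh ,
      (λ g≈id → f≉g λ x ex → trans (f≈id x ex) (sym (g≈id x ex))) ,
      (λ h≈id → f≉h λ x ex → trans (f≈id x ex) (sym (h≈id x ex))) , g≉h
... | no f≉id | yes g≈id = f , h , Sf , Sh , f≉id ,
      (λ h≈id → g≉h λ x ex → trans (g≈id x ex) (sym (h≈id x ex))) , f≉h
... | no f≉id | no g≉id = f , g , Sf , Sg , f≉id , g≉id , f≉g

-- The prime factors of 5040 = 16 · 315 with multiplicity, in the order in which `prime-order-power`
-- removes them.
odd-primes all-primes : List ℕ
odd-primes = 3 ∷ 3 ∷ 5 ∷ 7 ∷ []
all-primes = 2 ∷ 2 ∷ 2 ∷ 2 ∷ odd-primes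

odd-primes-prime : All Prime odd-primes
odd-primes-prime = from-yes (All.all? prime? odd-primes)

all-primes-prime : All Prime all-primes
all-primes-prime = prime[2] ∷ prime[2] ∷ prime[2] ∷ prime[2] ∷ odd-primes-prime

2∤13 : ¬ 2 ∣ 13
2∤13 = from-no (2 ∣? 13)

-- 2520 = lcm(1, …, 9)
exponent : ∀ {f : Map 9} {m} → 2 * 2520 ≡ m → IsG f → f ^^ m ≈ id
exponent {f} refl = IsG-exponent {f = f} {2520} (from-yes (Fin.all? {n = 9} λ d → suc (toℕ d) ∣? 2520))

HammingPart : (Fin 13 → Code 9) → Set
HammingPart 𝒞 = (i : Fin 13) → Equivalent (𝒞 i) DoublyExtHamming → AtLeast 2 (InAutFam 𝒞) →
  ∃ λ (H : List (Map 9)) → IsSubgroupOf (InAutFam 𝒞) H × Prime (length H) × All (InAut (𝒞 i)) H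

FixingSubgroup : (Fin 13 → Code 9) → Set
FixingSubgroup 𝒞 = ∃ λ (H : List (Map 9)) → IsSubgroupOf (InAutFam 𝒞) H
  × (length H ≡ 4 ⊎ (Prime (length H) × ¬ (2 ∣ length H)))
  × ∃ λ (i : Fin 13) → All (InAut (𝒞 i)) H

-- Subgroups that fix a code.

module _ {𝒞 : Fin 13 → Code 9} (partition : IsPartition 𝒞) where

  hamming-part : (∀ i → MinDist≥ 4 (𝒞 i)) → HammingPart 𝒞
  hamming-part minDist i equivalent two = subgroup (atLeast2⇒nontrivial two)
    where
    Subgroup : Set
    Subgroup = ∃ λ (H : List (Map 9)) →
      IsSubgroupOf (InAutFam 𝒞) H × Prime (length H) × All (InAut (𝒞 i)) H

    generated : ∀ {f} → InAutFam 𝒞 f →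
      (∃₂ λ p m → p ∈ all-primes × ¬ (f ^^ m ≈ id) × ((f ^^ m) ^^ p ≈ id)) → Subgroup
    generated {f} F (p , m , p∈ , f^m≉id , ^p≈id) =
      cyclic (f ^^ m) p ,
      prime-cyclic-subgroup p-prime (InAutFam-^^ F^m) ^p≈id f^m≉id ,
      subst Prime (sym (length-applyUpTo _ p)) p-prime ,
      cyclic-fixes partition F^m p (hamming-fixed partition minDist equivalent F^m)
      where
      F^m = InAutFam-^^ {f = f} F m
      p-prime = All.lookup all-primes-prime p∈

    subgroup : (∃ λ f → InAutFam 𝒞 f × ¬ f ≈ id) → Subgroup
    subgroup (f , F , f≉id) = generated F (prime-order-power {f = f} all-primes all-primes-prime
      (exponent {f} {product all-primes} refl (proj₁ F)) f≉id)

  odd-prime-order : ∀ {p} {f : Map 9} → p ∈ odd-primes → InAutFam 𝒞 f → ¬ f ≈ id → f ^^ p ≈ id →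
    FixingSubgroup 𝒞
  odd-prime-order {p} {f} p∈ F f≉id f^p≈id =
    cyclic f p , prime-cyclic-subgroup p-prime (InAutFam-^^ F) f^p≈id f≉id ,
    inj₂ (subst (λ l → Prime l × ¬ 2 ∣ l) (sym (length-applyUpTo _ p)) (p-prime , p-odd)) ,
    proj₁ fixed , cyclic-fixes partition F p (proj₂ fixed)
    where
    p-prime = All.lookup odd-primes-prime p∈
    p∤13 = All.lookup (from-yes (All.all? (λ p → ¬? (p ∣? 13)) odd-primes)) p∈
    p-odd = All.lookup (from-yes (All.all? (λ p → ¬? (2 ∣? p)) odd-primes)) p∈
    fixed = fixed-point p-prime p∤13 (action-period partition F p f^p≈id)

  -- The action `σ` on the 13 indices satisfies `σ ^^ 4 = id`. So `σ ^^ 2` has period 2, and so has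
  -- `σ` on the fixed points of `σ ^^ 2`; the fixed-point count applies twice.
  order-4 : ∀ {f : Map 9} → InAutFam 𝒞 f → ¬ f ^^ 2 ≈ id → f ^^ 4 ≈ id → FixingSubgroup 𝒞
  order-4 {f} F f²≉id f⁴≈id =
    cyclic f 4 , cyclic4-subgroup (InAutFam-^^ F) f⁴≈id f²≉id ,
    inj₁ refl , proj₁ fixed , cyclic-fixes partition F 4 (proj₂ (proj₂ fixed))
    where
    σ = action partition F
    fixed : ∃ λ i → (σ ^^ 2) i ≡ i × σ i ≡ i
    fixed = common-fixed-point prime[2] 2∤13 (action-period partition F 4 f⁴≈id)
      (λ _ → refl) (λ _ fixed → fixed)

  -- The actions of `g` and `h` commute and have period 2, so they fix a common index, and with them
  -- all of `klein` fixes that code.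
  klein-four : ∀ {g h : Map 9} → InAutFam 𝒞 g → InAutFam 𝒞 h → ¬ g ≈ id → ¬ h ≈ id → ¬ g ≈ h →
    g ^^ 2 ≈ id → h ^^ 2 ≈ id → (g ∘ h) ^^ 2 ≈ id → FixingSubgroup 𝒞
  klein-four {g} {h} G H g≉id h≉id g≉h g² h² gh² = subgroup
    (common-fixed-point prime[2] 2∤13 (action-period partition G 2 g²) actions-commute
      λ i _ → action-period partition H 2 h² i)
    where
    open Klein {g = g} {h} (IsG-even {f = g} (proj₁ G)) (IsG-even {f = h} (proj₁ H)) g² h² gh²
    σ = action partition G
    τ = action partition H
    GH : InAutFam 𝒞 (g ∘ h)
    GH = InAutFam-∘ {f = g} {h} G H

    -- `h ∘ g` and `g ∘ h` agree on even words, so they move `𝒞 i` into the same code.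
    actions-commute : ∀ i → σ (τ i) ≡ τ (σ i)
    actions-commute i = sym (moves-unique partition commute
      (λ x c → action-moves partition H _ _ (action-moves partition G i x c))
      (λ x c → action-moves partition G _ _ (action-moves partition H i x c)))

    subgroup : (∃ λ i → σ i ≡ i × τ i ≡ i) → FixingSubgroup 𝒞
    subgroup (i , σ-fixes-i , τ-fixes-i) =
      klein , klein-subgroup InAutFam-id G H GH g≉id h≉id g≉h , inj₁ refl , i ,
      fixes⇒InAut partition InAutFam-id (λ _ c → c) ∷ fixes⇒InAut partition G g-moves ∷
      fixes⇒InAut partition H h-moves ∷
      fixes⇒InAut partition GH (λ x c → g-moves _ (h-moves x c)) ∷ []
      where
      g-moves : Moves partition g i i
      g-moves = subst (Moves partition g i) σ-fixes-i (action-moves partition G i)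
      h-moves : Moves partition h i i
      h-moves = subst (Moves partition h i) τ-fixes-i (action-moves partition H i)

  -- If `f ^^ 16` is nontrivial, its order divides 315 and a power of it has odd prime order.
  -- Otherwise the order of `f` divides 16; if `f ^^ 2` is nontrivial, some `(f ^^ 2) ^^ m` has
  -- order 2, and then `f ^^ m` has order 4.
  involution-or-subgroup : ∀ {f : Map 9} → InAutFam 𝒞 f → f ^^ 2 ≈ id ⊎ FixingSubgroup 𝒞
  involution-or-subgroup {f} F = odd-case ((f ^^ 16) ≈? id)
    where
    odd-part : (∃₂ λ p m → p ∈ odd-primes × ¬ ((f ^^ 16) ^^ m ≈ id) × (((f ^^ 16) ^^ m) ^^ p ≈ id)) →
      FixingSubgroup 𝒞
    odd-part (p , m , p∈ , ≉id , ^p≈id) =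
      odd-prime-order p∈ (InAutFam-^^ (InAutFam-^^ F 16) m) ≉id ^p≈id

    swap : ∀ m x → ((f ^^ 2) ^^ m) x ≡ ((f ^^ m) ^^ 2) x
    swap m x = trans (^^-* f m 2 x) (trans (cong (λ k → (f ^^ k) x) (*-comm m 2)) (sym (^^-* f 2 m x)))

    two-part : (∃₂ λ p m → p ∈ 2 ∷ 2 ∷ 2 ∷ [] × ¬ ((f ^^ 2) ^^ m ≈ id) × (((f ^^ 2) ^^ m) ^^ p ≈ id)) →
      FixingSubgroup 𝒞
    two-part (p , m , p∈ , ≉id , ^p≈id) = order-4 (InAutFam-^^ F m)
      (λ e → ≉id λ x ex → trans (swap m x) (e x ex))
      (λ x ex → trans (sym (trans (swap m _) (cong ((f ^^ m) ^^ 2) (swap m x))))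
        (subst (λ p → ((f ^^ 2) ^^ m) ^^ p ≈ id) p≡2 ^p≈id x ex))
      where
      p≡2 : p ≡ 2
      p≡2 = All.lookup {P = _≡ 2} (refl ∷ refl ∷ refl ∷ []) p∈

    even-case : f ^^ 16 ≈ id → Dec (f ^^ 2 ≈ id) → f ^^ 2 ≈ id ⊎ FixingSubgroup 𝒞
    even-case _ (yes f²≈id) = inj₁ f²≈id
    even-case f¹⁶≈id (no f²≉id) = inj₂ (two-part (prime-order-power (2 ∷ 2 ∷ 2 ∷ [])
      (prime[2] ∷ prime[2] ∷ prime[2] ∷ []) (λ x ex → trans (^^-* f 8 2 x) (f¹⁶≈id x ex)) f²≉id))

    odd-case : Dec (f ^^ 16 ≈ id) → f ^^ 2 ≈ id ⊎ FixingSubgroup 𝒞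
    odd-case (yes f¹⁶≈id) = even-case f¹⁶≈id ((f ^^ 2) ≈? id)
    odd-case (no f¹⁶≉id) = inj₂ (odd-part (prime-order-power odd-primes odd-primes-prime
      (λ x ex → trans (^^-* f (product odd-primes) 16 x)
        (exponent {f} {product odd-primes * 16} refl (proj₁ F) x ex)) f¹⁶≉id))

  fixing-part : AtLeast 3 (InAutFam 𝒞) → FixingSubgroup 𝒞
  fixing-part three = from-two (atLeast3⇒two-nontrivial three)
    where
    from-two : (∃₂ λ g h → InAutFam 𝒞 g × InAutFam 𝒞 h × ¬ g ≈ id × ¬ h ≈ id × ¬ g ≈ h) →
      FixingSubgroup 𝒞
    from-two (g , h , G , H , g≉id , h≉id , g≉h) =
      combine (involution-or-subgroup G) (involution-or-subgroup H)
        (involution-or-subgroup (InAutFam-∘ {f = g} {h} G H))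
      where
      combine : g ^^ 2 ≈ id ⊎ FixingSubgroup 𝒞 → h ^^ 2 ≈ id ⊎ FixingSubgroup 𝒞 →
        (g ∘ h) ^^ 2 ≈ id ⊎ FixingSubgroup 𝒞 → FixingSubgroup 𝒞
      combine (inj₂ subgroup) _ _ = subgroup
      combine (inj₁ _) (inj₂ subgroup) _ = subgroup
      combine (inj₁ _) (inj₁ _) (inj₂ subgroup) = subgroup
      combine (inj₁ g²) (inj₁ h²) (inj₁ gh²) = klein-four G H g≉id h≉id g≉h g² h² gh²

theorem2 : (𝒞 : Fin 13 → Code 9) → IsPartition 𝒞 → (∀ i → MinDist≥ 4 (𝒞 i)) →
    ((i : Fin 13) → Equivalent (𝒞 i) DoublyExtHamming → AtLeast 2 (InAutFam 𝒞) →
    ∃ λ (H : List (Map 9)) → IsSubgroupOf (InAutFam 𝒞) H × Prime (length H)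
    × All (InAut (𝒞 i)) H)
    × (AtLeast 3 (InAutFam 𝒞) →
    ∃ λ (H : List (Map 9)) → IsSubgroupOf (InAutFam 𝒞) H
    × (length H ≡ 4 ⊎ (Prime (length H) × ¬ (2 ∣ length H)))
    × ∃ λ (i : Fin 13) → All (InAut (𝒞 i)) H)
theorem2 𝒞 partition minDist = hamming-part partition minDist , fixing-part partition
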